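{- Let $G=(V,E)$ be the complete graph on $n\ge5$ nodes. Let $V=V_1\cup\dots\cup V_m$ be a partition of $V$ into $m$ disjoint sets. Let $E_l=\{u_{l1}v_{l1},\dots,u_{lt_l}v_{lt_l}\}$ be the set of edges of the clique on $V_l$, where $t_l=\binom{|V_l|}{2}$, and let $F=E_1\cup\dots\cup E_m$. Let $G'=(V',E')$ be a graph with $n+\sum_{l=1}^m t_l$ nodes, $n$ of which are labelled by $V$, the others being grouped into sets $W_1,\dots,W_m$ with $W_l=\{w_{l1},\dots,w_{lt_l}\}$. Suppose: (i) the subgraph of $G'$ induced by $V$ is the complete $m$-partite graph $\mathrm{K}_{|V_1|,\dots,|V_m|}$ with parts $V_1,\dots,V_m$; (ii) for $l=1,\dots,m$, $W_l$ is an independent set in $G'$; (iii) for $l=1,\dots,m$ and $i=1,\dots,t_l$, $u_{li}w_{li},v_{li}w_{li}\in E'$. Then $G'$ is a triangular elimination of $G$ with respect to $F$ in which node $w_{li}$ is associated with edge $u_{li}v_{li}$, and every triangular elimination of any facet inducing inequality for $\mathrm{CUT}^\square(G)$ which is not a triangle inequality is facet inducing for $\mathrm{CUT}^\square(G')$.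
   Context: For a graph $G=(V,E)$ and $S\subseteq V$, the cut vector $\bm{\delta}_G(S)\in\mathbb{R}^E$ has $uv$-coordinate $1$ if $|S\cap\{u,v\}|=1$ and $0$ otherwise; $\mathrm{CUT}^\square(G)$ is the convex hull of all cut vectors. Facet inducing means valid with the induced face a facet. Coordinates are indexed by unordered pairs, $x_{uv}=x_{vu}$. For nodes $u,v,w$ define the triangular forms $\Delta(u,v;w)=x_{uv}-x_{uw}-x_{vw}$ and $\Delta(u,v,w)=x_{uv}+x_{uw}+x_{vw}-2$; $\Delta\{u,v,w\}$ denotes any one of $\Delta(u,v;w)$, $\Delta(w,v;u)$, $\Delta(u,w;v)$, $\Delta(u,v,w)$. A triangle inequality is one of the form $\lambda\Delta\{u,v,w\}\le0$ with $\lambda>0$ and $u,v,w$ distinct nodes. Given $F=\{u_iv_i\mid i=1,\dots,t\}\subseteq E$, a graph $G'=(V',E')$ is a triangular elimination of $G$ with respect to $F$ if $V'=V\cup\{w_1,\dots,w_t\}$ with $w_i$ distinct nodes not in $V$, $E'\supseteq\{w_iu_i,w_iv_i\}$ for all $i$, and $E'\cap E=E\setminus F$; $w_i$ is associated with $u_iv_i$. Then $(\bm{a}')^{\mathrm{T}}\bm{x}\le a'_0$ ($\bm a'\in\mathbb{R}^{E'}$) is a triangular elimination of $\bm{a}^{\mathrm{T}}\bm{x}\le a_0$ ($\bm a\in\mathbb{R}^E$) if for some choices of triangular forms $\Delta_i\{u_i,v_i,w_i\}$ one has the identity of affine functions $(\bm{a}')^{\mathrm{T}}\bm{x}-a'_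0=\bm{a}^{\mathrm{T}}\bm{x}-a_0+\sum_{i=1}^t|a_{u_iv_i}|\,\Delta_i\{u_i,v_i,w_i\}$.
   Formalization: The coefficients and right-hand sides of the inequalities (for both the facet inducing inequality and its triangular elimination) and the multiplier λ of a triangle inequality are rational rather than real. -}

module Defs where

open import Data.Nat using (ℕ; zero; suc)
open import Data.Bool using (Bool; true; false; not; _∧_; _xor_; if_then_else_)
open import Data.Fin using (Fin; toℕ; _≟_)
open import Data.Nat using () renaming (_<ᵇ_ to _<ᵇ_; _<_ to _<ℕ_)
open import Data.Rational using (ℚ; 0ℚ; 1ℚ; _+_; _*_; _-_; _≤_; _<_; ∣_∣)
open import Data.Product using (Σ; ∃; _×_; _,_)
open import Data.Sum using () renaming (_⊎_ to _⊎'_)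
open import Relation.Binary.PropositionalEquality using (_≡_; _≢_; refl) renaming (sym to sym≡)
open import Data.Empty using (⊥-elim)
open import Relation.Nullary using (¬_; yes; no)
open import Relation.Nullary.Decidable using (⌊_⌋)

∑ : ∀ {N} → (Fin N → ℚ) → ℚ
∑ {zero}  f = 0ℚ
∑ {suc N} f = f Fin.zero + ∑ (λ i → f (Fin.suc i))

∑pairs : ∀ {N} → (Fin N → Fin N → ℚ) → ℚ
∑pairs f = ∑ (λ u → ∑ (λ v → if toℕ u <ᵇ toℕ v then f u v else 0ℚ))

-- Vectors indexed by unordered pairs of nodes of a node set Fin N.
-- The coordinate of the pair {u,v} (u < v) is  x u v ; entries x u v
-- with u ≥ v are ignored everywhere.

PairVec : ℕ → Set
PairVec N = Fin N → Fin N → ℚ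

coord : ∀ {N} → PairVec N → Fin N → Fin N → ℚ
coord x u v = if toℕ u <ᵇ toℕ v then x u v else x v u

_·_ : ∀ {N} → PairVec N → PairVec N → ℚ
a · x = ∑pairs (λ u v → a u v * x u v)

record Graph (N : ℕ) : Set where
  field
    adj    : Fin N → Fin N → Bool
    sym    : ∀ u v → adj u v ≡ adj v u
    irrefl : ∀ u → adj u u ≡ false
open Graph public

private
  ≟-sym : ∀ {n} (u v : Fin n) → not ⌊ u ≟ v ⌋ ≡ not ⌊ v ≟ u ⌋
  ≟-sym u v with u ≟ v | v ≟ u
  ... | yes _ | yes _ = refl
  ... | no _  | no _  = refl
  ... | yes p | no q  = ⊥-elim (q (sym≡ p))
  ... | no p  | yes q = ⊥-elim (p (sym≡ q))

  ≟-irr : ∀ {n} (u : Fin n) → not ⌊ u ≟ u ⌋ ≡ false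
  ≟-irr u with u ≟ u
  ... | yes _ = refl
  ... | no p  = ⊥-elim (p refl)

K : (n : ℕ) → Graph n
K n = record { adj = λ u v → not ⌊ u ≟ v ⌋ ; sym = ≟-sym ; irrefl = ≟-irr }

-- vectors of ℝ^E : zero on every non-edge coordinate
InSpace : ∀ {N} → Graph N → PairVec N → Set
InSpace G a = ∀ u v → toℕ u <ℕ toℕ v → adj G u v ≡ false → a u v ≡ 0ℚ

Subset : ℕ → Set
Subset N = Fin N → Bool

cutVec : ∀ {N} → Graph N → Subset N → PairVec N
cutVec G S u v = if adj G u v ∧ (S u xor S v) then 1ℚ else 0ℚ

-- affine independence (over ℚ; cut vectors are 0/1 vectors, so this is
-- the same as over ℝ) of a family of k vectors
AffInd : ∀ {N k} → (Fin k → PairVec N) → Set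
AffInd {N} {k} xs =
  (λc : Fin k → ℚ) → ∑ λc ≡ 0ℚ →
  (∀ u v → toℕ u <ℕ toℕ v → ∑ (λ i → λc i * xs i u v) ≡ 0ℚ) →
  ∀ i → λc i ≡ 0ℚ

Valid : ∀ {N} → Graph N → PairVec N → ℚ → Set
Valid G a a0 = ∀ S → a · cutVec G S ≤ a0

-- facet inducing: valid, and the induced face is a facet of CUT(G).
-- Encoded with d = dim CUT(G): there are no d+2 affinely independent cut
-- vectors, there are d affinely independent cut vectors on the face, and
-- the face is proper (some cut vector is not on it).
FacetInducing : ∀ {N} → Graph N → PairVec N → ℚ → Set
FacetInducing {N} G a a0 =
  InSpace G a × Valid G a a0 ×
  (∃ λ S → a · cutVec G S ≢ a0) ×
  (∃ λ d →
     (¬ (Σ (Fin (suc (suc d)) → Subset N) λ Ss → AffInd (λ i → cutVec G (Ss i)))) ×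
     (Σ (Fin d → Subset N) λ Ss →
        (∀ i → a · cutVec G (Ss i) ≡ a0) × AffInd (λ i → cutVec G (Ss i))))

data Form : Set where
  f-uv∣w f-wv∣u f-uw∣v f-uvw : Form

2ℚ : ℚ
2ℚ = 1ℚ + 1ℚ

Δ : ∀ {N} → Form → Fin N → Fin N → Fin N → PairVec N → ℚ
Δ f-uv∣w u v w x = coord x u v - coord x u w - coord x v w
Δ f-wv∣u u v w x = coord x w v - coord x w u - coord x v u
Δ f-uw∣v u v w x = coord x u w - coord x u v - coord x w v
Δ f-uvw  u v w x = coord x u v + coord x u w + coord x v w - 2ℚ

IsTriangle : ∀ {N} → PairVec N → ℚ → Set
IsTriangle {N} a a0 =
  Σ ℚ λ λ₀ → (0ℚ < λ₀) × Σ (Fin N) λ u → Σ (Fin N) λ v → Σ (Fin N) λ w →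
  (u ≢ v) × (u ≢ w) × (v ≢ w) × Σ Form λ f →
  (∀ (x : PairVec N) → a · x - a0 ≡ λ₀ * Δ f u v w x)

-- Triangular elimination of a graph.
-- G on Fin n, F ⊆ E given by a Boolean predicate on pairs u < v,
-- G' on Fin N', ι : labelling of V inside V', w u v : the node associated
-- with the edge uv ∈ F (only meaningful for uv ∈ F, u < v).

InF : ∀ {n} → (Fin n → Fin n → Bool) → Fin n → Fin n → Set
InF F u v = (toℕ u <ℕ toℕ v) × (F u v ≡ true)

IsTriElimGraph : ∀ {n N'} → Graph n → (Fin n → Fin n → Bool) → Graph N' →
                 (Fin n → Fin N') → (Fin n → Fin n → Fin N') → Set
IsTriElimGraph {n} {N'} G F G' ι w =
  (∀ u v → InF F u v → adj G u v ≡ true) ×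
  (∀ u v → ι u ≡ ι v → u ≡ v) ×
  (∀ u v u₁ v₁ → InF F u v → InF F u₁ v₁ → w u v ≡ w u₁ v₁ → (u ≡ u₁) × (v ≡ v₁)) ×
  (∀ u v z → InF F u v → ι z ≢ w u v) ×
  (∀ p → (∃ λ z → ι z ≡ p) ⊎' (∃ λ u → ∃ λ v → InF F u v × (w u v ≡ p))) ×
  (∀ u v → InF F u v → (adj G' (w u v) (ι u) ≡ true) × (adj G' (w u v) (ι v) ≡ true)) ×
  (∀ u v → toℕ u <ℕ toℕ v → adj G u v ≡ true → adj G' (ι u) (ι v) ≡ not (F u v))

pull : ∀ {n N'} → (Fin n → Fin N') → PairVec N' → PairVec n
pull ι x u v = coord x (ι u) (ι v)

IsTriElimIneq : ∀ {n N'} → Graph N' → (Fin n → Fin n → Bool) →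
                (Fin n → Fin N') → (Fin n → Fin n → Fin N') →
                PairVec n → ℚ → PairVec N' → ℚ → Set
IsTriElimIneq {n} {N'} G' F ι w a a0 a' a0' =
  InSpace G' a' ×
  Σ (Fin n → Fin n → Form) λ c →
  ∀ (x : PairVec N') →
    a' · x - a0' ≡
      (a · pull ι x - a0) +
      ∑pairs (λ u v → if F u v then ∣ a u v ∣ * Δ (c u v) (ι u) (ι v) (w u v) x else 0ℚ)

samePart : ∀ {n m} → (Fin n → Fin m) → Fin n → Fin n → Bool
samePart part u v = ⌊ part u ≟ part v ⌋

Surj : ∀ {n m} → (Fin n → Fin m) → Set
Surj {n} {m} f = ∀ (l : Fin m) → ∃ λ (u : Fin n) → f u ≡ l

{-# OPTIONS --safe #-}
module Submission where

-- Write σ for the ±1 vector of a cut, so that 1 - 2 x_ij = σ_i σ_j. If a linear form L(σ) vanishes on all roots of a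
-- facet of the cut polytope of K_n with σ_u = ε σ_v, then (σ_u + ε σ_v) L(σ), which is affine in the cut vector,
-- vanishes on the whole facet and is a multiple of its inequality. A flip of a node z ∉ {u,v} with a nonzero coefficient
-- in L then shows that the triangle inequality given by (σ_u + ε σ_v)(σ_u ± σ_z) ≥ 0 is tight on the facet. So for a
-- facet that is no triangle inequality, L involves u and v only.
--
-- Let b · x = b₀ hold on all roots of the eliminated inequality. The node w associated with uv can be moved freely to
-- either side of a root in which uv is cut (or not cut, according to the triangular form). This gives a linear relation
-- Σ_q b_wq σ_q = 0 on those roots, so b_wq = 0 unless q is u or v. Every cut of K_n extends to G' with all the
-- triangular forms zero, and along these extensions b · x - b₀ is a multiple of a · x - a₀. Once the corresponding
-- multiple of a' · x - a'₀ is subtracted, it is zero along all extensions, and comparing coefficients gives b = 0.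

open import Defs hiding (sym)
import Algebra.Properties.Semiring.Sum
open import Algebra.Bundles using (CommutativeRing)
open import Data.Bool using (Bool; true; false; if_then_else_; _∧_; _xor_; not; T)
open import Data.Bool.Properties using (T-≡; xor-comm)
import Data.Bool.Properties as Bool
open import Data.Empty using (⊥; ⊥-elim)
open import Data.Fin using (Fin; zero; suc; toℕ; punchIn)
open import Data.Fin.Properties using (_≟_; all?; any?; ¬∀⟶∃¬; toℕ-injective)
open import Data.Fin.Subset.Properties using (anySubset?)
open import Data.List using (List; length; filter; allFin; cartesianProduct)
import Data.List as List
open import Data.List.Membership.Propositional using (_∈_)
open import Data.List.Membership.Propositional.Properties using (∈-filter⁺; ∈-filter⁻; ∈-cartesianProduct⁺; ∈-allFin; ∈-lookup)
import Data.List.Relation.Unary.All as All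
open import Data.List.Relation.Unary.AllPairs using (_∷_)
open import Data.List.Relation.Unary.Any using (index)
open import Data.List.Relation.Unary.Any.Properties using (lookup-index)
open import Data.List.Relation.Unary.Unique.Propositional using (Unique)
import Data.List.Relation.Unary.Unique.Propositional.Properties as Unique
open import Data.Nat using (ℕ; zero; suc; _<ᵇ_; s≤s) renaming (_≤_ to _≤ℕ_; _<_ to _<ℕ_; _<?_ to _<ℕ?_)
import Data.Nat.Properties as ℕ
open import Data.Product using (Σ; ∃; _×_; _,_; proj₁; proj₂; uncurry)
open import Data.Product.Properties using (≡-dec)
open import Data.Rational using (ℚ; 0ℚ; 1ℚ; ½; _+_; _*_; _-_; -_; _≤_; _<_; _≤ᵇ_; ∣_∣; 1/_; ≢-nonZero; nonNegative; nonPositive)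
open import Data.Rational.Properties as ℚ using (+-*-commutativeRing)
open import Data.Rational.Solver using (module +-*-Solver)
open import Data.Sum using (_⊎_; inj₁; inj₂)
open import Data.Unit using (tt)
open import Data.Vec using (lookup; tabulate)
open import Data.Vec.Functional using (insertAt; removeAt)
open import Data.Vec.Functional.Properties using (insertAt-lookup; insertAt-punchIn)
open import Data.Vec.Properties using (lookup∘tabulate)
open import Function using (_∘_; id)
open import Function.Bundles using (Equivalence)
open import Relation.Binary.Definitions using (tri<; tri≈; tri>)
open import Relation.Binary.PropositionalEquality using (_≡_; _≢_; _≗_; refl; sym; trans; cong; cong₂; subst; subst₂; module ≡-Reasoning)
open import Relation.Nullary using (¬_; Dec; yes; no; ¬?)
open import Relation.Nullary.Decidable using (⌊_⌋; _×-dec_; decidable-stable)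
open +-*-Solver using (solve; con; _:=_; _:+_; _:*_; _:-_; :-_)
open ≡-Reasoning

-- Several nodes of G' may copy the same node z of K_n. In the relation Σ_q b_wq σ_q = 0, read along
-- extensions, the coefficient of σ_z is therefore a sum over all copies of z. For this reason the
-- entries between two new nodes have to be shown to vanish before the entry between w and z can be
-- isolated.
--
-- A facet is defined by counting affinely independent cuts, whereas the argument speaks about
-- equations. From cuts to equations, a function that vanishes on the roots without being a multiple
-- of the inequality would produce one independent cut too many. From equations to cuts, roots are
-- chosen greedily: each uses up one of |E| + 1 independent functionals, until a single one is left.
-- A root for the next step can be found by search because there are finitely many cuts and equality
-- of rationals is decidable.

private module Sum = Algebra.Properties.Semiring.Sum (CommutativeRing.semiring +-*-commutativeRing)

⌊≟⌋-refl : ∀ {N} (i : Fin N) → ⌊ i ≟ i ⌋ ≡ true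
⌊≟⌋-refl i with i ≟ i
... | yes _   = refl
... | no i≢i = ⊥-elim (i≢i refl)

⌊≟⌋-≢ : ∀ {N} {i j : Fin N} → i ≢ j → ⌊ i ≟ j ⌋ ≡ false
⌊≟⌋-≢ {i = i} {j} i≢j with i ≟ j
... | yes i≡j = ⊥-elim (i≢j i≡j)
... | no _    = refl

-- Finite sums

∑≡sum : ∀ {N} (f : Fin N → ℚ) → ∑ f ≡ Sum.sum f
∑≡sum {zero}  f = refl
∑≡sum {suc N} f = cong (f zero +_) (∑≡sum (f ∘ suc))

∑-cong : ∀ {N} {f g : Fin N → ℚ} → (∀ i → f i ≡ g i) → ∑ f ≡ ∑ g
∑-cong {zero}  h = refl
∑-cong {suc N} h = cong₂ _+_ (h zero) (∑-cong (h ∘ suc))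

∑-zero : ∀ {N} {f : Fin N → ℚ} → (∀ i → f i ≡ 0ℚ) → ∑ f ≡ 0ℚ
∑-zero {zero}  h = refl
∑-zero {suc N} h = trans (cong₂ _+_ (h zero) (∑-zero (h ∘ suc))) (ℚ.+-identityˡ 0ℚ)

∑-+ : ∀ {N} (f g : Fin N → ℚ) → ∑ (λ i → f i + g i) ≡ ∑ f + ∑ g
∑-+ f g = trans (∑≡sum λ i → f i + g i) (trans (Sum.∑-distrib-+ f g) (sym (cong₂ _+_ (∑≡sum f) (∑≡sum g))))

∑-*ˡ : ∀ {N} c (f : Fin N → ℚ) → ∑ (λ i → c * f i) ≡ c * ∑ f
∑-*ˡ c f = trans (∑≡sum λ i → c * f i) (trans (sym (Sum.*-distribˡ-sum c f)) (cong (c *_) (sym (∑≡sum f))))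

∑-*ʳ : ∀ {N} c (f : Fin N → ℚ) → ∑ (λ i → f i * c) ≡ ∑ f * c
∑-*ʳ c f = trans (∑-cong λ i → ℚ.*-comm (f i) c) (trans (∑-*ˡ c f) (ℚ.*-comm c _))

∑-swap : ∀ {M N} (f : Fin M → Fin N → ℚ) → ∑ (λ i → ∑ (f i)) ≡ ∑ (λ j → ∑ (λ i → f i j))
∑-swap f = begin
  ∑ (λ i → ∑ (f i))                   ≡⟨ ∑-cong (λ i → ∑≡sum (f i)) ⟩
  ∑ (λ i → Sum.sum (f i))             ≡⟨ ∑≡sum (λ i → Sum.sum (f i)) ⟩
  Sum.sum (λ i → Sum.sum (f i))       ≡⟨ Sum.∑-comm f ⟩
  Sum.sum (λ j → Sum.sum (λ i → f i j)) ≡⟨ ∑≡sum (λ j → Sum.sum (λ i → f i j)) ⟨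
  ∑ (λ j → Sum.sum (λ i → f i j))     ≡⟨ ∑-cong (λ j → ∑≡sum (λ i → f i j)) ⟨
  ∑ (λ j → ∑ (λ i → f i j))           ∎

∑-remove : ∀ {N} (i : Fin (suc N)) (f : Fin (suc N) → ℚ) → ∑ f ≡ f i + ∑ (removeAt f i)
∑-remove i f = trans (∑≡sum f) (trans (Sum.sum-remove {i = i} f) (cong (f i +_) (sym (∑≡sum (removeAt f i)))))

∑-single : ∀ {N} (p : Fin N) (f : Fin N → ℚ) → (∀ i → i ≢ p → f i ≡ 0ℚ) → ∑ f ≡ f p
∑-single {suc N} zero f h =
  trans (cong (f zero +_) (∑-zero λ i → h (suc i) λ ())) (ℚ.+-identityʳ (f zero))
∑-single {suc N} (suc p) f h =
  trans (cong₂ _+_ (h zero λ ()) (∑-single p (f ∘ suc) λ i i≢p → h (suc i) λ { refl → i≢p refl }))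
        (ℚ.+-identityˡ (f (suc p)))

<⇒<ᵇ≡true : ∀ {m n} → m <ℕ n → (m <ᵇ n) ≡ true
<⇒<ᵇ≡true m<n = Equivalence.to T-≡ (ℕ.<⇒<ᵇ m<n)

≮⇒<ᵇ≡false : ∀ {m n} → ¬ (m <ℕ n) → (m <ᵇ n) ≡ false
≮⇒<ᵇ≡false {m} {n} m≮n with m <ᵇ n in eq
... | false = refl
... | true  = ⊥-elim (m≮n (ℕ.<ᵇ⇒< m n (Equivalence.from T-≡ eq)))

<ᵇ≡true⇒< : ∀ {m n} → (m <ᵇ n) ≡ true → m <ℕ n
<ᵇ≡true⇒< {m} {n} eq = ℕ.<ᵇ⇒< m n (Equivalence.from T-≡ eq)

module _ {N : ℕ} where

  ordered : (Fin N → Fin N → ℚ) → Fin N → Fin N → ℚ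
  ordered f u v = if toℕ u <ᵇ toℕ v then f u v else 0ℚ

  ordered-< : ∀ f {u v} → toℕ u <ℕ toℕ v → ordered f u v ≡ f u v
  ordered-< f u<v rewrite <⇒<ᵇ≡true u<v = refl

  ordered-cases : ∀ (P : Bool → Set) (u v : Fin N) → (toℕ u <ℕ toℕ v → P true) → P false → P (toℕ u <ᵇ toℕ v)
  ordered-cases P u v t f with toℕ u <ᵇ toℕ v in eq
  ... | true  = t (<ᵇ≡true⇒< eq)
  ... | false = f

  ∑pairs-cong : ∀ {f g : Fin N → Fin N → ℚ} → (∀ u v → toℕ u <ℕ toℕ v → f u v ≡ g u v) → ∑pairs f ≡ ∑pairs g
  ∑pairs-cong {f} {g} h = ∑-cong λ u → ∑-cong λ v →
    ordered-cases (λ b → (if b then f u v else 0ℚ) ≡ (if b then g u v else 0ℚ)) u v (h u v) refl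

  ∑pairs-zero : ∀ {f : Fin N → Fin N → ℚ} → (∀ u v → toℕ u <ℕ toℕ v → f u v ≡ 0ℚ) → ∑pairs f ≡ 0ℚ
  ∑pairs-zero {f} h = ∑-zero λ u → ∑-zero λ v →
    ordered-cases (λ b → (if b then f u v else 0ℚ) ≡ 0ℚ) u v (h u v) refl

  ∑pairs-+ : ∀ (f g : Fin N → Fin N → ℚ) → ∑pairs (λ u v → f u v + g u v) ≡ ∑pairs f + ∑pairs g
  ∑pairs-+ f g = trans (∑-cong λ u → trans (∑-cong λ v → split (toℕ u <ᵇ toℕ v) (f u v) (g u v)) (∑-+ (ordered f u) (ordered g u)))
                         (∑-+ (λ u → ∑ (ordered f u)) (λ u → ∑ (ordered g u)))
    where
    split : ∀ b x y → (if b then x + y else 0ℚ) ≡ (if b then x else 0ℚ) + (if b then y else 0ℚ)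
    split true  x y = refl
    split false x y = refl

  ∑pairs-*ˡ : ∀ c (f : Fin N → Fin N → ℚ) → ∑pairs (λ u v → c * f u v) ≡ c * ∑pairs f
  ∑pairs-*ˡ c f = trans (∑-cong λ u → trans (∑-cong λ v → split (toℕ u <ᵇ toℕ v) (f u v)) (∑-*ˡ c (ordered f u)))
                      (∑-*ˡ c (λ u → ∑ (ordered f u)))
    where
    split : ∀ b x → (if b then c * x else 0ℚ) ≡ c * (if b then x else 0ℚ)
    split true  x = refl
    split false x = sym (ℚ.*-zeroʳ c)

  ∑pairs-∑ : ∀ {K} (f : Fin K → Fin N → Fin N → ℚ) →
             ∑pairs (λ u v → ∑ (λ k → f k u v)) ≡ ∑ (λ k → ∑pairs (f k))
  ∑pairs-∑ f = begin
    ∑pairs (λ u v → ∑ (λ k → f k u v))                      ≡⟨ ∑-cong (λ u → trans (∑-cong λ v → split (toℕ u <ᵇ toℕ v) (λ k → f k u v)) (∑-swap (λ v k → ordered (f k) u v))) ⟩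
    ∑ (λ u → ∑ (λ k → ∑ (λ v → ordered (f k) u v)))         ≡⟨ ∑-swap (λ u k → ∑ (ordered (f k) u)) ⟩
    ∑ (λ k → ∑pairs (f k))                                  ∎
    where
    split : ∀ {K} b (x : Fin K → ℚ) → (if b then ∑ x else 0ℚ) ≡ ∑ (λ k → if b then x k else 0ℚ)
    split true  x = refl
    split false x = sym (∑-zero {f = λ k → if false then x k else 0ℚ} λ _ → refl)

  ∑pairs-single : ∀ {p q : Fin N} (f : Fin N → Fin N → ℚ) → toℕ p <ℕ toℕ q →
                  (∀ u v → toℕ u <ℕ toℕ v → ¬ (u ≡ p × v ≡ q) → f u v ≡ 0ℚ) → ∑pairs f ≡ f p q
  ∑pairs-single {p} {q} f p<q h = begin
    ∑pairs f             ≡⟨ ∑-single p _ (λ u u≢p → ∑-zero λ v → off u v λ e → u≢p (proj₁ e)) ⟩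
    ∑ (ordered f p)      ≡⟨ ∑-single q _ (λ v v≢q → off p v λ e → v≢q (proj₂ e)) ⟩
    ordered f p q        ≡⟨ ordered-< f p<q ⟩
    f p q                ∎
    where
    off : ∀ u v → ¬ (u ≡ p × v ≡ q) → ordered f u v ≡ 0ℚ
    off u v ne = ordered-cases (λ b → (if b then f u v else 0ℚ) ≡ 0ℚ) u v (λ u<v → h u v u<v ne) refl

  ∑pairs-nonpos : ∀ (f : Fin N → Fin N → ℚ) → (∀ u v → f u v ≤ 0ℚ) → ∑pairs f ≤ 0ℚ
  ∑pairs-nonpos f h = ∑≤0 λ u → ∑≤0 λ v →
    ordered-cases (λ b → (if b then f u v else 0ℚ) ≤ 0ℚ) u v (λ _ → h u v) ℚ.≤-refl
    where
    ∑≤0 : ∀ {K} {g : Fin K → ℚ} → (∀ i → g i ≤ 0ℚ) → ∑ g ≤ 0ℚ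
    ∑≤0 {zero}  k = ℚ.≤-refl
    ∑≤0 {suc K} k = ℚ.+-mono-≤ (k zero) (∑≤0 (k ∘ suc))

  -- Moving one node changes a row and a column of the matrix of pairs, which is awkward to describe
  -- over u < v. Counting every pair twice removes the order.
  ∑∑-symmetric : ∀ (f : Fin N → Fin N → ℚ) → (∀ u v → f u v ≡ f v u) → (∀ u → f u u ≡ 0ℚ) →
                 ∑ (λ u → ∑ (f u)) ≡ ∑pairs f + ∑pairs f
  ∑∑-symmetric f f-sym f-diag = begin
    ∑ (λ u → ∑ (f u))                                              ≡⟨ ∑-cong (λ u → ∑-cong (halves u)) ⟩
    ∑ (λ u → ∑ (λ v → ordered f u v + ordered f v u))              ≡⟨ trans (∑-cong λ u → ∑-+ (ordered f u) (λ v → ordered f v u)) (∑-+ (λ u → ∑ (ordered f u)) (λ u → ∑ (λ v → ordered f v u))) ⟩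
    ∑pairs f + ∑ (λ u → ∑ (λ v → ordered f v u))                   ≡⟨ cong (∑pairs f +_) (∑-swap (λ u v → ordered f v u)) ⟩
    ∑pairs f + ∑pairs f                                            ∎
    where
    halves : ∀ u v → f u v ≡ ordered f u v + ordered f v u
    halves u v with ℕ.<-cmp (toℕ u) (toℕ v)
    ... | tri< a _ c rewrite <⇒<ᵇ≡true a | ≮⇒<ᵇ≡false c = sym (ℚ.+-identityʳ _)
    ... | tri≈ a b c rewrite ≮⇒<ᵇ≡false a | ≮⇒<ᵇ≡false c with toℕ-injective b
    ...   | refl = f-diag u
    halves u v | tri> a _ c rewrite <⇒<ᵇ≡true c | ≮⇒<ᵇ≡false a = trans (f-sym u v) (sym (ℚ.+-identityˡ _))

-- Linear algebra

*-≢0 : ∀ {x y} → x * y ≡ 0ℚ → y ≢ 0ℚ → x ≡ 0ℚ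
*-≢0 {x} {y} xy≡0 y≢0 = begin
  x               ≡⟨ ℚ.*-identityʳ x ⟨
  x * 1ℚ          ≡⟨ cong (x *_) (ℚ.*-inverseʳ y) ⟨
  x * (y * 1/ y)  ≡⟨ ℚ.*-assoc x y _ ⟨
  x * y * 1/ y    ≡⟨ cong (_* 1/ y) xy≡0 ⟩
  0ℚ * 1/ y       ≡⟨ ℚ.*-zeroˡ (1/ y) ⟩
  0ℚ              ∎
  where instance _ = ≢-nonZero y≢0

⟨_,_⟩ : ∀ {D} → (Fin D → ℚ) → (Fin D → ℚ) → ℚ
⟨ g , x ⟩ = ∑ (λ i → g i * x i)

Independent : ∀ {k D} → (Fin k → Fin D → ℚ) → Set
Independent {k} g = (μ : Fin k → ℚ) → (∀ i → ∑ (λ j → μ j * g j i) ≡ 0ℚ) → ∀ j → μ j ≡ 0ℚ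

Independent-removeAt : ∀ {k D} {g : Fin (suc k) → Fin D → ℚ} p → Independent g → Independent (removeAt g p)
Independent-removeAt {g = g} p ind μ h j = begin
  μ j                           ≡⟨ insertAt-punchIn μ p 0ℚ j ⟨
  insertAt μ p 0ℚ (punchIn p j) ≡⟨ ind (insertAt μ p 0ℚ) vanish (punchIn p j) ⟩
  0ℚ                            ∎
  where
  vanish : ∀ i → ∑ (λ j → insertAt μ p 0ℚ j * g j i) ≡ 0ℚ
  vanish i = begin
    ∑ (λ j → insertAt μ p 0ℚ j * g j i)  ≡⟨ ∑-remove p (λ j → insertAt μ p 0ℚ j * g j i) ⟩
    insertAt μ p 0ℚ p * g p i + ∑ (λ j → insertAt μ p 0ℚ (punchIn p j) * g (punchIn p j) i)
      ≡⟨ cong₂ _+_ (trans (cong (_* g p i) (insertAt-lookup μ p 0ℚ)) (ℚ.*-zeroˡ (g p i)))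
                   (trans (∑-cong λ j → cong (_* g (punchIn p j) i) (insertAt-punchIn μ p 0ℚ j)) (h i)) ⟩
    0ℚ                                   ∎

⟨⟩-sub : ∀ {D} c (g h x : Fin D → ℚ) → ⟨ (λ i → g i - c * h i) , x ⟩ ≡ ⟨ g , x ⟩ - c * ⟨ h , x ⟩
⟨⟩-sub c g h x = begin
  ∑ (λ i → (g i - c * h i) * x i)             ≡⟨ ∑-cong (λ i → solve 4 (λ a c b x → (a :- c :* b) :* x := a :* x :+ (:- c) :* (b :* x)) refl (g i) c (h i) (x i)) ⟩
  ∑ (λ i → g i * x i + (- c) * (h i * x i))   ≡⟨ ∑-+ (λ i → g i * x i) (λ i → (- c) * (h i * x i)) ⟩
  ⟨ g , x ⟩ + ∑ (λ i → (- c) * (h i * x i))   ≡⟨ cong (⟨ g , x ⟩ +_) (∑-*ˡ (- c) (λ i → h i * x i)) ⟩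
  ⟨ g , x ⟩ + (- c) * ⟨ h , x ⟩               ≡⟨ cong (⟨ g , x ⟩ +_) (sym (ℚ.neg-distribˡ-* c ⟨ h , x ⟩)) ⟩
  ⟨ g , x ⟩ - c * ⟨ h , x ⟩                   ∎

-- The hyperplane x^⊥ meets the span of the g j in codimension at most one.
module Pivot {s D} (g : Fin (suc s) → Fin D → ℚ) (x : Fin D → ℚ) (p : Fin (suc s)) (gp≢0 : ⟨ g p , x ⟩ ≢ 0ℚ) where

  private instance nz = ≢-nonZero gp≢0

  ratio : Fin s → ℚ
  ratio j = ⟨ g (punchIn p j) , x ⟩ * 1/ ⟨ g p , x ⟩

  reduced : Fin s → Fin D → ℚ
  reduced j i = g (punchIn p j) i - ratio j * g p i

  reduced-⊥ : ∀ j → ⟨ reduced j , x ⟩ ≡ 0ℚ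
  reduced-⊥ j = begin
    ⟨ reduced j , x ⟩                         ≡⟨ ⟨⟩-sub (ratio j) (g (punchIn p j)) (g p) x ⟩
    a - a * 1/ b * b                          ≡⟨ cong (λ z → a - z) (ℚ.*-assoc a (1/ b) b) ⟩
    a - a * (1/ b * b)                        ≡⟨ cong (λ z → a - a * z) (ℚ.*-inverseˡ b) ⟩
    a - a * 1ℚ                                ≡⟨ cong (λ z → a - z) (ℚ.*-identityʳ a) ⟩
    a - a                                     ≡⟨ ℚ.+-inverseʳ a ⟩
    0ℚ                                        ∎
    where
    a = ⟨ g (punchIn p j) , x ⟩
    b = ⟨ g p , x ⟩

  reduced-keeps : ∀ y → (∀ j → ⟨ g j , y ⟩ ≡ 0ℚ) → ∀ j → ⟨ reduced j , y ⟩ ≡ 0ℚ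
  reduced-keeps y h j = begin
    ⟨ reduced j , y ⟩                                ≡⟨ ⟨⟩-sub (ratio j) (g (punchIn p j)) (g p) y ⟩
    ⟨ g (punchIn p j) , y ⟩ - ratio j * ⟨ g p , y ⟩  ≡⟨ cong₂ (λ a b → a - ratio j * b) (h _) (h p) ⟩
    0ℚ - ratio j * 0ℚ                                ≡⟨ solve 1 (λ r → con 0ℚ :- r :* con 0ℚ := con 0ℚ) refl (ratio j) ⟩
    0ℚ                                               ∎

  reduced-independent : Independent g → Independent reduced
  reduced-independent ind μ h j = begin
    μ j                                   ≡⟨ insertAt-punchIn μ p c j ⟨
    insertAt μ p c (punchIn p j)          ≡⟨ ind (insertAt μ p c) vanish (punchIn p j) ⟩
    0ℚ                                    ∎
    where
    -- The weight of `g p` takes back the multiples of `g p` subtracted in `reduced`, so that both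
    -- combinations agree.
    c : ℚ
    c = - ∑ (λ j → μ j * ratio j)
    vanish : ∀ i → ∑ (λ j → insertAt μ p c j * g j i) ≡ 0ℚ
    vanish i = begin
      ∑ (λ j → insertAt μ p c j * g j i)
        ≡⟨ ∑-remove p (λ j → insertAt μ p c j * g j i) ⟩
      insertAt μ p c p * g p i + ∑ (λ j → insertAt μ p c (punchIn p j) * g (punchIn p j) i)
        ≡⟨ cong₂ (λ a b → a * g p i + b) (insertAt-lookup μ p c)
                 (∑-cong λ j → trans (cong (_* g (punchIn p j) i) (insertAt-punchIn μ p c j))
                   (solve 4 (λ m a r b → m :* a := m :* (a :- r :* b) :+ b :* (m :* r)) refl
                      (μ j) (g (punchIn p j) i) (ratio j) (g p i))) ⟩
      c * g p i + ∑ (λ j → μ j * reduced j i + g p i * (μ j * ratio j))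
        ≡⟨ cong (c * g p i +_) (trans (∑-+ (λ j → μ j * reduced j i) (λ j → g p i * (μ j * ratio j)))
                                        (cong₂ _+_ (h i) (∑-*ˡ (g p i) (λ j → μ j * ratio j)))) ⟩
      c * g p i + (0ℚ + g p i * ∑ (λ j → μ j * ratio j))
        ≡⟨ solve 2 (λ s b → (:- s) :* b :+ (con 0ℚ :+ b :* s) := con 0ℚ) refl (∑ (λ j → μ j * ratio j)) (g p i) ⟩
      0ℚ ∎

all-or-some : ∀ {k} {P : Fin k → Set} → (∀ i → Dec (P i)) → (∀ i → P i) ⊎ (∃ λ i → ¬ P i)
all-or-some {P = P} P? with all? P?
... | yes all = inj₁ all
... | no ¬all = inj₂ (¬∀⟶∃¬ _ P P? ¬all)

unit : ∀ {D} → Fin D → Fin D → ℚ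
unit i j = if ⌊ i ≟ j ⌋ then 1ℚ else 0ℚ

unit-self : ∀ {D} (i : Fin D) → unit i i ≡ 1ℚ
unit-self i rewrite ⌊≟⌋-refl i = refl

unit-other : ∀ {D} {i j : Fin D} → i ≢ j → unit i j ≡ 0ℚ
unit-other {i = i} {j} ne rewrite ⌊≟⌋-≢ ne = refl

unit-independent : ∀ {D} → Independent (unit {D})
unit-independent μ h i = begin
  μ i                          ≡⟨ ℚ.*-identityʳ (μ i) ⟨
  μ i * 1ℚ                     ≡⟨ cong (μ i *_) (unit-self i) ⟨
  μ i * unit i i               ≡⟨ ∑-single i _ (λ j j≢i → trans (cong (μ j *_) (unit-other j≢i)) (ℚ.*-zeroʳ (μ j))) ⟨
  ∑ (λ j → μ j * unit j i)     ≡⟨ h i ⟩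
  0ℚ                           ∎

-- Each vector `x i` costs one functional, so one of the r + 1 survives. The condition on all `y`
-- encodes that `h` lies in the span of `g`; it carries orthogonality to `x zero` through the
-- recursion.
annihilator : ∀ {r D} (x : Fin r → Fin D → ℚ) (g : Fin (suc r) → Fin D → ℚ) → Independent g →
              Σ (Fin 1 → Fin D → ℚ) λ h → Independent h ×
                (∀ y → (∀ j → ⟨ g j , y ⟩ ≡ 0ℚ) → ∀ j → ⟨ h j , y ⟩ ≡ 0ℚ) × (∀ j i → ⟨ h j , x i ⟩ ≡ 0ℚ)
annihilator {zero}  x g ind = g , ind , (λ y k → k) , λ j ()
annihilator {suc r} x g ind with all-or-some (λ j → ⟨ g j , x zero ⟩ ℚ.≟ 0ℚ)
... | inj₁ all =
  let h , ind′ , keep , kill = annihilator (x ∘ suc) (removeAt g zero) (Independent-removeAt {g = g} zero ind)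
  in  h , ind′ , (λ y k → keep y (k ∘ suc)) ,
      λ { j zero → keep (x zero) (all ∘ suc) j ; j (suc i) → kill j i }
... | inj₂ (p , gp≢0) =
  let open Pivot g (x zero) p gp≢0
      h , ind′ , keep , kill = annihilator (x ∘ suc) reduced (reduced-independent ind)
  in  h , ind′ , (λ y k → keep y (reduced-keeps y k)) ,
      λ { j zero → keep (x zero) reduced-⊥ j ; j (suc i) → kill j i }

-- A nonzero functional that kills all D columns of `y` is a linear dependence among its D + 1 rows.
¬Independent-suc : ∀ {D} (y : Fin (suc D) → Fin D → ℚ) → ¬ Independent y
¬Independent-suc y ind =
  let h , ind′ , _ , kill = annihilator (λ i j → y j i) unit unit-independent
      h≡0 = ind (h zero) (kill zero)
      1≡0 = ind′ (λ _ → 1ℚ) (λ i → trans (cong (λ a → 1ℚ * a + 0ℚ) (h≡0 i)) refl) zero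
  in  ℚ.1≢0 1≡0

-- Greedy choice of independent points

private
  distrib-sub : ∀ m a c b → m * (a - c * b) ≡ m * a + (- c) * (m * b)
  distrib-sub = solve 4 (λ m a c b → m :* (a :- c :* b) := m :* a :+ (:- c) :* (m :* b)) refl

  add-zero-term : ∀ m s → s ≡ m * 0ℚ + s
  add-zero-term = solve 2 (λ m s → s := m :* con 0ℚ :+ s) refl

  zero-combination : ∀ c → 0ℚ + c * 0ℚ ≡ 0ℚ
  zero-combination = solve 1 (λ c → con 0ℚ :+ c :* con 0ℚ := con 0ℚ) refl

module _ {N D} (vec : Subset N → Fin D → ℚ) (vec-cong : ∀ {S S′} → S ≗ S′ → ∀ i → vec S i ≡ vec S′ i)
         (P : Subset N → Set) (P? : ∀ S → Dec (P S)) (P-resp : ∀ {S S′} → S ≗ S′ → P S → P S′)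
         (separate : ∀ {s} (g : Fin (suc (suc s)) → Fin D → ℚ) → Independent g →
                     ¬ (∀ S → P S → ∀ j → ⟨ g j , vec S ⟩ ≡ 0ℚ)) where

  -- `separate` only refutes a universal statement; the witness comes from an exhaustive search over
  -- bit vectors. `vec-cong` and `P-resp` pass between a subset and its table, which agree only
  -- pointwise.
  find-separated : ∀ {s} (g : Fin (suc (suc s)) → Fin D → ℚ) → Independent g →
                   Σ (Subset N) λ S → P S × ∃ λ j → ⟨ g j , vec S ⟩ ≢ 0ℚ
  find-separated g ind
    with anySubset? (λ v → P? (lookup v) ×-dec any? λ j → ¬? (⟨ g j , vec (lookup v) ⟩ ℚ.≟ 0ℚ))
  ... | yes (v , found) = lookup v , found
  ... | no none = ⊥-elim (separate g ind vanish)
    where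
    vanish : ∀ S → P S → ∀ j → ⟨ g j , vec S ⟩ ≡ 0ℚ
    vanish S PS j with ⟨ g j , vec S ⟩ ℚ.≟ 0ℚ
    ... | yes z = z
    ... | no nz = ⊥-elim (none (tabulate S , P-resp same PS , j ,
                    λ z → nz (trans (∑-cong λ i → cong (g j i *_) (vec-cong same i)) z)))
      where
      same : S ≗ lookup (tabulate S)
      same i = sym (lookup∘tabulate S i)

  -- The recursion runs on a shrinking family of functionals, so independence is measured through
  -- the values of `g` alone. This implies independence of the vectors themselves.
  IndependentAgainst : ∀ {s t} → (Fin t → Fin D → ℚ) → (Fin s → Subset N) → Set
  IndependentAgainst {s} g Ss =
    (μ : Fin s → ℚ) → (∀ j → ∑ (λ k → μ k * ⟨ g j , vec (Ss k) ⟩) ≡ 0ℚ) → ∀ k → μ k ≡ 0ℚ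

  cons : ∀ {s} → Subset N → (Fin s → Subset N) → Fin (suc s) → Subset N
  cons S Ss zero    = S
  cons S Ss (suc k) = Ss k

  module _ {s} (g : Fin (suc (suc s)) → Fin D → ℚ) (S : Subset N) (p : Fin (suc (suc s))) (gp≢0 : ⟨ g p , vec S ⟩ ≢ 0ℚ)
           (Ss : Fin s → Subset N) where

    open Pivot g (vec S) p gp≢0

    private module Combine (μ : Fin (suc s) → ℚ) (h : ∀ j → ∑ (λ k → μ k * ⟨ g j , vec (cons S Ss k) ⟩) ≡ 0ℚ) where

      value : Fin (suc (suc s)) → Fin (suc s) → ℚ
      value j k = ⟨ g j , vec (cons S Ss k) ⟩

      combination : ∀ c j → ∑ (λ k → μ k * (value j k - c * value p k)) ≡ 0ℚ
      combination c j = begin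
        ∑ (λ k → μ k * (value j k - c * value p k))
          ≡⟨ ∑-cong (λ k → distrib-sub (μ k) (value j k) c (value p k)) ⟩
        ∑ (λ k → μ k * value j k + (- c) * (μ k * value p k))
          ≡⟨ trans (∑-+ (λ k → μ k * value j k) (λ k → (- c) * (μ k * value p k)))
                   (cong₂ _+_ (h j) (trans (∑-*ˡ (- c) (λ k → μ k * value p k)) (cong ((- c) *_) (h p)))) ⟩
        0ℚ + (- c) * 0ℚ
          ≡⟨ zero-combination (- c) ⟩
        0ℚ ∎

      tail-vanishes : ∀ j → ∑ (λ k → μ (suc k) * ⟨ reduced j , vec (Ss k) ⟩) ≡ 0ℚ
      tail-vanishes j = begin
        ∑ (λ k → μ (suc k) * ⟨ reduced j , vec (Ss k) ⟩)
          ≡⟨ ∑-cong (λ k → cong (μ (suc k) *_) (⟨⟩-sub (ratio j) (g (punchIn p j)) (g p) (vec (Ss k)))) ⟩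
        ∑ (λ k → μ (suc k) * q (suc k))
          ≡⟨ add-zero-term (μ zero) (∑ (λ k → μ (suc k) * q (suc k))) ⟩
        μ zero * 0ℚ + ∑ (λ k → μ (suc k) * q (suc k))
          ≡⟨ cong (λ z → μ zero * z + ∑ (λ k → μ (suc k) * q (suc k))) q-zero ⟨
        ∑ (λ k → μ k * q k)
          ≡⟨ combination (ratio j) (punchIn p j) ⟩
        0ℚ ∎
        where
        q : Fin (suc s) → ℚ
        q k = value (punchIn p j) k - ratio j * value p k
        q-zero : q zero ≡ 0ℚ
        q-zero = trans (sym (⟨⟩-sub (ratio j) (g (punchIn p j)) (g p) (vec S))) (reduced-⊥ j)

      head-zero : (∀ k → μ (suc k) ≡ 0ℚ) → μ zero ≡ 0ℚ
      head-zero tail = *-≢0 (trans (sym (∑-single zero (λ k → μ k * value p k) off)) (h p)) gp≢0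
        where
        off : ∀ k → k ≢ zero → μ k * value p k ≡ 0ℚ
        off zero    ne = ⊥-elim (ne refl)
        off (suc k) _  = trans (cong (_* value p (suc k)) (tail k)) (ℚ.*-zeroˡ (value p (suc k)))

    -- The reduced functionals vanish at `vec S` and so see only the tail; once its coefficients are
    -- zero, `g p` isolates the head.
    cons-independent : IndependentAgainst reduced Ss → IndependentAgainst g (cons S Ss)
    cons-independent indep μ h = λ { zero → head-zero tail ; (suc k) → tail k }
      where
      open Combine μ h
      tail : ∀ k → μ (suc k) ≡ 0ℚ
      tail = indep (μ ∘ suc) tail-vanishes

  -- Each chosen point uses up one functional as pivot. The count stops with one functional left,
  -- since `separate` says nothing about a single one: the equation of a face vanishes on all its
  -- points.
  independent-points : ∀ {s} (g : Fin (suc s) → Fin D → ℚ) → Independent g →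
                       Σ (Fin s → Subset N) λ Ss → (∀ k → P (Ss k)) × IndependentAgainst g Ss
  independent-points {zero}  g ind = (λ ()) , (λ ()) , λ _ _ ()
  independent-points {suc s} g ind =
    let S , PS , p , gp≢0 = find-separated g ind
        Ss , PSs , indep  = independent-points (Pivot.reduced g (vec S) p gp≢0) (Pivot.reduced-independent g (vec S) p gp≢0 ind)
    in  cons S Ss , (λ { zero → PS ; (suc k) → PSs k }) , cons-independent g S p gp≢0 Ss indep

⟨unit,⟩ : ∀ {D} (j : Fin D) (x : Fin D → ℚ) → ⟨ unit j , x ⟩ ≡ x j
⟨unit,⟩ j x = begin
  ∑ (λ i → unit j i * x i)  ≡⟨ ∑-single j (λ i → unit j i * x i) (λ i i≢j → trans (cong (_* x i) (unit-other (i≢j ∘ sym))) (ℚ.*-zeroˡ (x i))) ⟩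
  unit j j * x j            ≡⟨ cong (_* x j) (unit-self j) ⟩
  1ℚ * x j                  ≡⟨ ℚ.*-identityˡ (x j) ⟩
  x j                       ∎

lookup-injective : ∀ {A : Set} {xs : List A} → Unique xs → ∀ {i j} → List.lookup xs i ≡ List.lookup xs j → i ≡ j
lookup-injective (x≢ ∷ u) {zero}  {zero}  eq = refl
lookup-injective (x≢ ∷ u) {zero}  {suc j} eq = ⊥-elim (All.lookup x≢ (∈-lookup j) eq)
lookup-injective (x≢ ∷ u) {suc i} {zero}  eq = ⊥-elim (All.lookup x≢ (∈-lookup i) (sym eq))
lookup-injective (x≢ ∷ u) {suc i} {suc j} eq = cong suc (lookup-injective u eq)

-- Edge enumeration

module Edges {N} (G : Graph N) where

  IsEdge : Fin N × Fin N → Set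
  IsEdge (u , v) = toℕ u <ℕ toℕ v × adj G u v ≡ true

  isEdge? : ∀ e → Dec (IsEdge e)
  isEdge? (u , v) = (toℕ u <ℕ? toℕ v) ×-dec (adj G u v Bool.≟ true)

  edges : List (Fin N × Fin N)
  edges = filter isEdge? (cartesianProduct (allFin N) (allFin N))

  ∣E∣ : ℕ
  ∣E∣ = length edges

  edge : Fin ∣E∣ → Fin N × Fin N
  edge = List.lookup edges

  edge-isEdge : ∀ i → IsEdge (edge i)
  edge-isEdge i = proj₂ (∈-filter⁻ isEdge? {xs = cartesianProduct (allFin N) (allFin N)} (∈-lookup i))

  edge-injective : ∀ {i j} → edge i ≡ edge j → i ≡ j
  edge-injective = lookup-injective (Unique.filter⁺ isEdge? (Unique.cartesianProduct⁺ (Unique.allFin⁺ N) (Unique.allFin⁺ N)))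

  edge-onto : ∀ {u v} → IsEdge (u , v) → ∃ λ i → edge i ≡ (u , v)
  edge-onto {u} {v} e = index mem , sym (lookup-index mem)
    where
    mem : (u , v) ∈ edges
    mem = ∈-filter⁺ isEdge? (∈-cartesianProduct⁺ (∈-allFin u) (∈-allFin v)) e

-- Inner products of pair vectors

·-comb : ∀ {N K} (b : PairVec N) (c : Fin K → ℚ) (x : Fin K → PairVec N) →
         b · (λ u v → ∑ (λ k → c k * x k u v)) ≡ ∑ (λ k → c k * (b · x k))
·-comb b c x = begin
  ∑pairs (λ u v → b u v * ∑ (λ k → c k * x k u v))
    ≡⟨ ∑pairs-cong (λ u v _ → trans (sym (∑-*ˡ (b u v) (λ k → c k * x k u v)))
                                    (∑-cong λ k → *-exchange (b u v) (c k) (x k u v))) ⟩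
  ∑pairs (λ u v → ∑ (λ k → c k * (b u v * x k u v)))
    ≡⟨ ∑pairs-∑ (λ k u v → c k * (b u v * x k u v)) ⟩
  ∑ (λ k → ∑pairs (λ u v → c k * (b u v * x k u v)))
    ≡⟨ ∑-cong (λ k → ∑pairs-*ˡ (c k) (λ u v → b u v * x k u v)) ⟩
  ∑ (λ k → c k * (b · x k)) ∎
  where
  *-exchange : ∀ a b c → a * (b * c) ≡ b * (a * c)
  *-exchange = solve 3 (λ a b c → a :* (b :* c) := b :* (a :* c)) refl

·-comm : ∀ {N} (b x : PairVec N) → b · x ≡ x · b
·-comm b x = ∑pairs-cong λ u v _ → ℚ.*-comm (b u v) (x u v)

·-congʳ : ∀ {N} (b : PairVec N) {x y : PairVec N} → (∀ u v → toℕ u <ℕ toℕ v → x u v ≡ y u v) → b · x ≡ b · y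
·-congʳ b h = ∑pairs-cong λ u v u<v → cong (b u v *_) (h u v u<v)

cutVec-cong : ∀ {N} (G : Graph N) {S S′} → S ≗ S′ → ∀ u v → cutVec G S u v ≡ cutVec G S′ u v
cutVec-cong G h u v = cong₂ (λ a b → if adj G u v ∧ (a xor b) then 1ℚ else 0ℚ) (h u) (h v)

e[_] : ∀ {N} → Fin N × Fin N → PairVec N
e[ p ] u v = if ⌊ ≡-dec _≟_ _≟_ (u , v) p ⌋ then 1ℚ else 0ℚ

e-self : ∀ {N} (u v : Fin N) → e[ u , v ] u v ≡ 1ℚ
e-self u v with ≡-dec _≟_ _≟_ (u , v) (u , v)
... | yes _ = refl
... | no ne = ⊥-elim (ne refl)

e-other : ∀ {N} {u v : Fin N} {p} → (u , v) ≢ p → e[ p ] u v ≡ 0ℚ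
e-other {u = u} {v} {p} ne with ≡-dec _≟_ _≟_ (u , v) p
... | yes eq = ⊥-elim (ne eq)
... | no _   = refl

·-e : ∀ {N} (x : PairVec N) {u v} → toℕ u <ℕ toℕ v → x · e[ u , v ] ≡ x u v
·-e x {u} {v} u<v = begin
  x · e[ u , v ]          ≡⟨ ∑pairs-single (λ p q → x p q * e[ u , v ] p q) u<v
                              (λ p q _ ne → trans (cong (x p q *_) (e-other λ { refl → ne (refl , refl) })) (ℚ.*-zeroʳ (x p q))) ⟩
  x u v * e[ u , v ] u v  ≡⟨ cong (x u v *_) (e-self u v) ⟩
  x u v * 1ℚ              ≡⟨ ℚ.*-identityʳ (x u v) ⟩
  x u v                   ∎

-- A facet criterion: the equation of the face is unique up to scaling

private
  +-zero⇒neg : ∀ x y → x + y ≡ 0ℚ → y ≡ - x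
  +-zero⇒neg x y h = begin
    y            ≡⟨ solve 2 (λ x y → y := (x :+ y) :- x) refl x y ⟩
    (x + y) - x  ≡⟨ cong (_- x) h ⟩
    0ℚ - x       ≡⟨ ℚ.+-identityˡ (- x) ⟩
    - x          ∎

  neg-neg : ∀ s → s ≡ - (- s)
  neg-neg = solve 1 (λ s → s := :- (:- s)) refl

  neg-scale : ∀ x t c → - x ≡ t * c → x ≡ t * (- c)
  neg-scale x t c h = begin
    x          ≡⟨ neg-neg x ⟩
    - (- x)    ≡⟨ cong -_ h ⟩
    - (t * c)  ≡⟨ ℚ.neg-distribʳ-* t c ⟩
    t * (- c)  ∎

  cross-cancel : ∀ s t x → t * (s * x) + (- s) * (t * x) ≡ 0ℚ
  cross-cancel = solve 3 (λ s t x → t :* (s :* x) :+ (:- s) :* (t :* x) := con 0ℚ) refl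

  unit-combination : ∀ x → 1ℚ * 0ℚ + 0ℚ * x ≡ 0ℚ
  unit-combination = solve 1 (λ x → con 1ℚ :* con 0ℚ :+ con 0ℚ :* x := con 0ℚ) refl

module FacetCriterion {N} (G : Graph N) (a : PairVec N) (a0 : ℚ) where

  Root : Subset N → Set
  Root S = a · cutVec G S ≡ a0

  -- The dual form of the facet property: the equations satisfied by all roots are spanned by the
  -- inequality itself.
  Uniqueness : Set
  Uniqueness = ∀ b b0 → InSpace G b → (∀ S → Root S → b · cutVec G S ≡ b0) →
               ∃ λ t → (∀ u v → toℕ u <ℕ toℕ v → adj G u v ≡ true → b u v ≡ t * a u v) × b0 ≡ t * a0

  open Edges G

  -- The leading 1 homogenises: affine independence of cut vectors becomes linear independence, and
  -- an affine equation becomes a functional.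
  vec : Subset N → Fin (suc ∣E∣) → ℚ
  vec S zero    = 1ℚ
  vec S (suc i) = uncurry (cutVec G S) (edge i)

  vec-cong : ∀ {S S′} → S ≗ S′ → ∀ i → vec S i ≡ vec S′ i
  vec-cong h zero    = refl
  vec-cong h (suc i) = uncurry (cutVec-cong G h) (edge i)

  private
    module _ (g : Fin (suc ∣E∣) → ℚ) where

      pairVec : PairVec N
      pairVec u v = ∑ (λ i → g (suc i) * e[ edge i ] u v)

      pairVec-edge : ∀ i → uncurry pairVec (edge i) ≡ g (suc i)
      pairVec-edge i = begin
        ∑ (λ j → g (suc j) * uncurry e[ edge j ] (edge i))
          ≡⟨ ∑-single i (λ j → g (suc j) * uncurry e[ edge j ] (edge i))
               (λ j j≢i → trans (cong (g (suc j) *_) (e-other {p = edge j} λ eq → j≢i (edge-injective (sym eq)))) (ℚ.*-zeroʳ (g (suc j)))) ⟩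
        g (suc i) * uncurry e[ edge i ] (edge i)  ≡⟨ cong (g (suc i) *_) (uncurry e-self (edge i)) ⟩
        g (suc i) * 1ℚ                            ≡⟨ ℚ.*-identityʳ (g (suc i)) ⟩
        g (suc i)                                 ∎

      pairVec-InSpace : InSpace G pairVec
      pairVec-InSpace u v u<v nonadj = ∑-zero λ i →
        trans (cong (g (suc i) *_) (e-other λ eq → case-contra (trans (sym nonadj) (subst (λ e → uncurry (adj G) e ≡ true) (sym eq) (proj₂ (edge-isEdge i))))))
              (ℚ.*-zeroʳ (g (suc i)))
        where
        case-contra : false ≡ true → ⊥
        case-contra ()

      pairVec-· : ∀ S → ⟨ g , vec S ⟩ ≡ g zero + pairVec · cutVec G S
      pairVec-· S = begin
        g zero * 1ℚ + ∑ (λ i → g (suc i) * uncurry (cutVec G S) (edge i))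
          ≡⟨ cong₂ _+_ (ℚ.*-identityʳ (g zero)) (∑-cong λ i → cong (g (suc i) *_) (sym (·-e (cutVec G S) (proj₁ (edge-isEdge i))))) ⟩
        g zero + ∑ (λ i → g (suc i) * (cutVec G S · e[ edge i ]))
          ≡⟨ cong (g zero +_) (·-comb (cutVec G S) (g ∘ suc) (λ i → e[ edge i ])) ⟨
        g zero + cutVec G S · pairVec
          ≡⟨ cong (g zero +_) (·-comm (cutVec G S) pairVec) ⟩
        g zero + pairVec · cutVec G S ∎

    normal : Fin (suc ∣E∣) → ℚ
    normal zero    = - a0
    normal (suc i) = uncurry a (edge i)

    multiple : Uniqueness → ∀ g → (∀ S → Root S → ⟨ g , vec S ⟩ ≡ 0ℚ) → ∃ λ t → ∀ i → g i ≡ t * normal i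
    multiple uniq g h =
      let t , edges-eq , const-eq = uniq (pairVec g) (- g zero) (pairVec-InSpace g)
            (λ S r → +-zero⇒neg (g zero) (pairVec g · cutVec G S) (trans (sym (pairVec-· g S)) (h S r)))
      in  t , λ { zero    → neg-scale (g zero) t a0 const-eq
                ; (suc i) → trans (sym (pairVec-edge g i))
                              (edges-eq (proj₁ (edge i)) (proj₂ (edge i)) (proj₁ (edge-isEdge i)) (proj₂ (edge-isEdge i))) }

    coeffs : ∀ {s} → ℚ → ℚ → Fin (suc (suc s)) → ℚ
    coeffs c d zero          = c
    coeffs c d (suc zero)    = d
    coeffs c d (suc (suc _)) = 0ℚ

    coeffs-∑ : ∀ {s} c d (x : Fin (suc (suc s)) → ℚ) → ∑ (λ j → coeffs c d j * x j) ≡ c * x zero + d * x (suc zero)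
    coeffs-∑ c d x =
      cong (c * x zero +_) (trans (cong (d * x (suc zero) +_) (∑-zero λ j → ℚ.*-zeroˡ (x (suc (suc j))))) (ℚ.+-identityʳ (d * x (suc zero))))

    -- The combination of `g zero` and `g (suc zero)` with coefficients q and -p is zero, which
    -- forces p = 0 and then `g zero` = 0. No case distinction on p and q is required.
    no-two-multiples : ∀ {s} (g : Fin (suc (suc s)) → Fin (suc ∣E∣) → ℚ) → Independent g → ∀ p q →
                       (∀ i → g zero i ≡ p * normal i) → (∀ i → g (suc zero) i ≡ q * normal i) → ⊥
    no-two-multiples g ind p q eq₀ eq₁ = ℚ.1≢0 (ind (coeffs 1ℚ 0ℚ) g₀-dependent zero)
      where
      dependent : ∀ i → ∑ (λ j → coeffs q (- p) j * g j i) ≡ 0ℚ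
      dependent i = begin
        ∑ (λ j → coeffs q (- p) j * g j i)              ≡⟨ coeffs-∑ q (- p) (λ j → g j i) ⟩
        q * g zero i + (- p) * g (suc zero) i           ≡⟨ cong₂ (λ x y → q * x + (- p) * y) (eq₀ i) (eq₁ i) ⟩
        q * (p * normal i) + (- p) * (q * normal i)     ≡⟨ cross-cancel p q (normal i) ⟩
        0ℚ                                              ∎
      p≡0 : p ≡ 0ℚ
      p≡0 = trans (neg-neg p) (cong -_ (ind (coeffs q (- p)) dependent (suc zero)))
      g₀≡0 : ∀ i → g zero i ≡ 0ℚ
      g₀≡0 i = trans (eq₀ i) (trans (cong (_* normal i) p≡0) (ℚ.*-zeroˡ (normal i)))
      g₀-dependent : ∀ i → ∑ (λ j → coeffs 1ℚ 0ℚ j * g j i) ≡ 0ℚ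
      g₀-dependent i = begin
        ∑ (λ j → coeffs 1ℚ 0ℚ j * g j i)           ≡⟨ coeffs-∑ 1ℚ 0ℚ (λ j → g j i) ⟩
        1ℚ * g zero i + 0ℚ * g (suc zero) i        ≡⟨ cong (λ x → 1ℚ * x + 0ℚ * g (suc zero) i) (g₀≡0 i) ⟩
        1ℚ * 0ℚ + 0ℚ * g (suc zero) i              ≡⟨ unit-combination (g (suc zero) i) ⟩
        0ℚ                                         ∎

    separate : Uniqueness → ∀ {s} (g : Fin (suc (suc s)) → Fin (suc ∣E∣) → ℚ) → Independent g →
               ¬ (∀ S → Root S → ∀ j → ⟨ g j , vec S ⟩ ≡ 0ℚ)
    separate uniq g ind h =
      let p , eq₀ = multiple uniq (g zero) (λ S r → h S r zero)
          q , eq₁ = multiple uniq (g (suc zero)) (λ S r → h S r (suc zero))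
      in  no-two-multiples g ind p q eq₀ eq₁

  -- With `∣E∣` as the dimension, both counts are linear algebra on `vec`: |E| + 2 affinely
  -- independent cuts would be too many vectors for |E| + 1 coordinates, and `independent-points`,
  -- started from the unit functionals, yields |E| roots.
  facetInducing : InSpace G a → Valid G a a0 → (∃ λ S → a · cutVec G S ≢ a0) → Uniqueness → FacetInducing G a a0
  facetInducing inSpace valid proper uniq = inSpace , valid , proper , ∣E∣ , at-most , at-least
    where
    at-most : ¬ (Σ (Fin (suc (suc ∣E∣)) → Subset N) λ Ss → AffInd (λ i → cutVec G (Ss i)))
    at-most (Ss , aff) = ¬Independent-suc (λ k → vec (Ss k)) λ μ h →
      aff μ (trans (∑-cong λ k → sym (ℚ.*-identityʳ (μ k))) (h zero)) (coordinates μ h)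
      where
      coordinates : ∀ μ → (∀ i → ∑ (λ k → μ k * vec (Ss k) i) ≡ 0ℚ) →
                    ∀ u v → toℕ u <ℕ toℕ v → ∑ (λ k → μ k * cutVec G (Ss k) u v) ≡ 0ℚ
      coordinates μ h u v u<v with adj G u v in adj-uv
      ... | false = ∑-zero λ k → ℚ.*-zeroʳ (μ k)
      ... | true with edge-onto (u<v , adj-uv)
      ...   | i , eq = trans (∑-cong λ k → cong (μ k *_) (trans (sym (cong (λ b → if b ∧ (Ss k u xor Ss k v) then 1ℚ else 0ℚ) adj-uv))
                                                                (cong (uncurry (cutVec G (Ss k))) (sym eq)))) (h (suc i))
    at-least : Σ (Fin ∣E∣ → Subset N) λ Ss → (∀ i → Root (Ss i)) × AffInd (λ i → cutVec G (Ss i))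
    at-least =
      let Ss , roots , indep = independent-points vec vec-cong Root (λ S → a · cutVec G S ℚ.≟ a0)
                                 (λ same r → trans (sym (·-congʳ a λ u v _ → cutVec-cong G same u v)) r)
                                 (separate uniq) unit unit-independent
      in  Ss , roots , λ μ sum≡0 coords≡0 → indep μ
            λ { zero    → trans (∑-cong λ k → trans (cong (μ k *_) (⟨unit,⟩ zero (vec (Ss k)))) (ℚ.*-identityʳ (μ k))) sum≡0
              ; (suc i) → trans (∑-cong λ k → cong (μ k *_) (⟨unit,⟩ (suc i) (vec (Ss k)))) (coords≡0 _ _ (proj₁ (edge-isEdge i))) }

-- Cuts as sign vectors

sg : Bool → ℚ
sg false = 1ℚ
sg true  = - 1ℚ

χ : Bool → ℚ
χ b = if b then 1ℚ else 0ℚ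

sg-square : ∀ b → sg b * sg b ≡ 1ℚ
sg-square true  = refl
sg-square false = refl

sg-xor : ∀ a b → sg (a xor b) ≡ sg a * sg b
sg-xor true  true  = refl
sg-xor true  false = refl
sg-xor false true  = refl
sg-xor false false = refl

sg-χ : ∀ a b → 1ℚ - 2ℚ * χ (a xor b) ≡ sg a * sg b
sg-χ true  true  = refl
sg-χ true  false = refl
sg-χ false true  = refl
sg-χ false false = refl

sg-cancel : ∀ b x → sg b * x ≡ 0ℚ → x ≡ 0ℚ
sg-cancel b x h = begin
  x                   ≡⟨ ℚ.*-identityˡ x ⟨
  1ℚ * x              ≡⟨ cong (_* x) (sg-square b) ⟨
  sg b * sg b * x     ≡⟨ ℚ.*-assoc (sg b) (sg b) x ⟩
  sg b * (sg b * x)   ≡⟨ cong (sg b *_) h ⟩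
  sg b * 0ℚ           ≡⟨ ℚ.*-zeroʳ (sg b) ⟩
  0ℚ                  ∎

2*-cancel : ∀ x → 2ℚ * x ≡ 0ℚ → x ≡ 0ℚ
2*-cancel x h = *-≢0 (trans (ℚ.*-comm x 2ℚ) h) (λ ())

flip : ∀ {N} → Fin N → Subset N → Subset N
flip p S q = ⌊ p ≟ q ⌋ xor S q

flip-other : ∀ {N} {p q : Fin N} S → p ≢ q → flip p S q ≡ S q
flip-other S p≢q rewrite ⌊≟⌋-≢ p≢q = refl

private
  sg-flip : ∀ {N} (p q : Fin N) S → sg (flip p S q) ≡ sg (S q) - 2ℚ * sg (S p) * unit p q
  sg-flip p q S with p ≟ q
  ... | no _ = drop (sg (S q)) (2ℚ * sg (S p))
    where
    drop : ∀ x y → x ≡ x - y * 0ℚ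
    drop = solve 2 (λ x y → x := x :- y :* con 0ℚ) refl
  ... | yes refl = negate (S p)
    where
    negate : ∀ b → sg (not b) ≡ sg b - 2ℚ * sg b * 1ℚ
    negate true  = refl
    negate false = refl

-- `κ` need not be injective, since several nodes of G' copy one node of K_n. The coefficient of the
-- sign at `z` is therefore the sum of `c` over a fibre of `κ`.
linear-flip : ∀ {N K} (c : Fin K → ℚ) (κ : Fin K → Fin N) z S →
              ∑ (λ k → c k * sg (flip z S (κ k))) ≡
              ∑ (λ k → c k * sg (S (κ k))) - 2ℚ * sg (S z) * ∑ (λ k → c k * unit z (κ k))
linear-flip c κ z S = begin
  ∑ (λ k → c k * sg (flip z S (κ k)))
    ≡⟨ ∑-cong (λ k → trans (cong (c k *_) (sg-flip z (κ k) S)) (expand (c k) (sg (S (κ k))) (2ℚ * sg (S z)) (unit z (κ k)))) ⟩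
  ∑ (λ k → c k * sg (S (κ k)) + (- (2ℚ * sg (S z))) * (c k * unit z (κ k)))
    ≡⟨ ∑-+ (λ k → c k * sg (S (κ k))) (λ k → (- (2ℚ * sg (S z))) * (c k * unit z (κ k))) ⟩
  ∑ (λ k → c k * sg (S (κ k))) + ∑ (λ k → (- (2ℚ * sg (S z))) * (c k * unit z (κ k)))
    ≡⟨ cong (∑ (λ k → c k * sg (S (κ k))) +_) (∑-*ˡ (- (2ℚ * sg (S z))) (λ k → c k * unit z (κ k))) ⟩
  ∑ (λ k → c k * sg (S (κ k))) + (- (2ℚ * sg (S z))) * ∑ (λ k → c k * unit z (κ k))
    ≡⟨ cong (∑ (λ k → c k * sg (S (κ k))) +_) (ℚ.neg-distribˡ-* (2ℚ * sg (S z)) (∑ (λ k → c k * unit z (κ k)))) ⟨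
  ∑ (λ k → c k * sg (S (κ k))) - 2ℚ * sg (S z) * ∑ (λ k → c k * unit z (κ k)) ∎
  where
  expand : ∀ c s t u → c * (s - t * u) ≡ c * s + (- t) * (c * u)
  expand = solve 4 (λ c s t u → c :* (s :- t :* u) := c :* s :+ (:- t) :* (c :* u)) refl

-- Cuts of a weighted graph

coord-< : ∀ {N} (x : PairVec N) {u v} → toℕ u <ℕ toℕ v → coord x u v ≡ x u v
coord-< x u<v rewrite <⇒<ᵇ≡true u<v = refl

coord-> : ∀ {N} (x : PairVec N) {u v} → toℕ v <ℕ toℕ u → coord x u v ≡ x v u
coord-> x v<u rewrite ≮⇒<ᵇ≡false (ℕ.<⇒≯ v<u) = refl

distinct : ∀ {N} {u v : Fin N} → toℕ u <ℕ toℕ v → u ≢ v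
distinct u<v refl = ℕ.<-irrefl refl u<v

≢-ordered : ∀ {N} {u v : Fin N} (P : Fin N → Fin N → Set) → (∀ {u v} → P u v → P v u) →
            (∀ u v → toℕ u <ℕ toℕ v → P u v) → u ≢ v → P u v
≢-ordered {u = u} {v} P P-sym h u≢v with ℕ.<-cmp (toℕ u) (toℕ v)
... | tri< u<v _ _ = h u v u<v
... | tri≈ _ u≡v _ = ⊥-elim (u≢v (toℕ-injective u≡v))
... | tri> _ _ v<u = P-sym (h v u v<u)

coord-sym : ∀ {N} (x : PairVec N) u v → coord x u v ≡ coord x v u
coord-sym x u v with ℕ.<-cmp (toℕ u) (toℕ v)
... | tri< u<v _ _ = trans (coord-< x u<v) (sym (coord-> x u<v))
... | tri≈ _ u≡v _ rewrite toℕ-injective u≡v = refl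
... | tri> _ _ v<u = trans (coord-> x v<u) (sym (coord-< x v<u))

weight : ∀ {N} → Graph N → PairVec N → Fin N → Fin N → ℚ
weight G b p q = if adj G p q then coord b p q else 0ℚ

module _ {N} (G : Graph N) (b : PairVec N) where

  weight-sym : ∀ p q → weight G b p q ≡ weight G b q p
  weight-sym p q = cong₂ (λ t x → if t then x else 0ℚ) (Graph.sym G p q) (coord-sym b p q)

  weight-diag : ∀ p → weight G b p p ≡ 0ℚ
  weight-diag p = cong (λ t → if t then coord b p p else 0ℚ) (Graph.irrefl G p)

  weight-edge : ∀ {p q} → adj G p q ≡ true → weight G b p q ≡ coord b p q
  weight-edge {p} {q} e = cong (λ t → if t then coord b p q else 0ℚ) e

  weight-nonedge : ∀ {p q} → adj G p q ≡ false → weight G b p q ≡ 0ℚ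
  weight-nonedge {p} {q} e = cong (λ t → if t then coord b p q else 0ℚ) e

  cut-weight : ∀ S → b · cutVec G S ≡ ∑pairs (λ u v → weight G b u v * χ (S u xor S v))
  cut-weight S = ∑pairs-cong λ u v u<v →
    trans (cong (_* cutVec G S u v) (sym (coord-< b u<v))) (move (adj G u v) (coord b u v) (S u xor S v))
    where
    move : ∀ e x s → x * (if e ∧ s then 1ℚ else 0ℚ) ≡ (if e then x else 0ℚ) * χ s
    move true  x s = refl
    move false x s = trans (ℚ.*-zeroʳ x) (sym (ℚ.*-zeroˡ (χ s)))

  -- Only pairs through `p` change, and x_pq changes by σ_p σ_q. The computation counts every pair
  -- twice, as (u,v) and (v,u), so that the change splits into the row and the column of `p`, which
  -- are equal.
  cut-flip : ∀ p S → b · cutVec G (flip p S) - b · cutVec G S ≡ sg (S p) * ∑ (λ q → weight G b p q * sg (S q))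
  cut-flip p S = halve (begin
    X + X                                                         ≡⟨ cong₂ _+_ X≡ X≡ ⟩
    ∑pairs δ + ∑pairs δ                                           ≡⟨ ∑∑-symmetric δ δ-sym δ-diag ⟨
    ∑ (λ u → ∑ (δ u))                                             ≡⟨ ∑-cong (λ u → ∑-cong (local u)) ⟩
    ∑ (λ u → ∑ (λ v → unit p u * g v + unit p v * g u))           ≡⟨ ∑-cong (λ u → ∑-+ (λ v → unit p u * g v) (λ v → unit p v * g u)) ⟩
    ∑ (λ u → ∑ (λ v → unit p u * g v) + ⟨ unit p , (λ _ → g u) ⟩) ≡⟨ ∑-cong (λ u → cong₂ _+_ (∑-*ˡ (unit p u) g) (⟨unit,⟩ p (λ _ → g u))) ⟩
    ∑ (λ u → unit p u * ∑ g + g u)                                ≡⟨ ∑-+ (λ u → unit p u * ∑ g) g ⟩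
    ⟨ unit p , (λ _ → ∑ g) ⟩ + ∑ g                                ≡⟨ cong (_+ ∑ g) (⟨unit,⟩ p (λ _ → ∑ g)) ⟩
    ∑ g + ∑ g                                                     ≡⟨ cong₂ _+_ g≡ g≡ ⟩
    Y + Y ∎)
    where
    X Y : ℚ
    X = b · cutVec G (flip p S) - b · cutVec G S
    Y = sg (S p) * ∑ (λ q → weight G b p q * sg (S q))
    χ′ : Fin N → Fin N → ℚ
    χ′ u v = χ (flip p S u xor flip p S v) - χ (S u xor S v)
    δ : Fin N → Fin N → ℚ
    δ u v = weight G b u v * χ′ u v
    g : Fin N → ℚ
    g v = sg (S p) * (weight G b p v * sg (S v))
    g≡ : ∑ g ≡ Y
    g≡ = ∑-*ˡ (sg (S p)) (λ q → weight G b p q * sg (S q))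
    δ-sym : ∀ u v → δ u v ≡ δ v u
    δ-sym u v = cong₂ _*_ (weight-sym u v) (cong₂ (λ s t → χ s - χ t) (xor-comm (flip p S u) (flip p S v)) (xor-comm (S u) (S v)))
    δ-diag : ∀ u → δ u u ≡ 0ℚ
    δ-diag u = trans (cong (_* χ′ u u) (weight-diag u)) (ℚ.*-zeroˡ (χ′ u u))
    X≡ : X ≡ ∑pairs δ
    X≡ = begin
      b · cutVec G (flip p S) - b · cutVec G S
        ≡⟨ cong₂ _-_ (cut-weight (flip p S)) (cut-weight S) ⟩
      ∑pairs W′ - ∑pairs W
        ≡⟨ cong (∑pairs W′ +_) (neg (∑pairs W)) ⟩
      ∑pairs W′ + (- 1ℚ) * ∑pairs W
        ≡⟨ cong (∑pairs W′ +_) (∑pairs-*ˡ (- 1ℚ) W) ⟨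
      ∑pairs W′ + ∑pairs (λ u v → (- 1ℚ) * W u v)
        ≡⟨ ∑pairs-+ W′ (λ u v → (- 1ℚ) * W u v) ⟨
      ∑pairs (λ u v → W′ u v + (- 1ℚ) * W u v)
        ≡⟨ ∑pairs-cong (λ u v _ → factor (weight G b u v) (χ (flip p S u xor flip p S v)) (χ (S u xor S v))) ⟩
      ∑pairs δ ∎
      where
      W′ W : Fin N → Fin N → ℚ
      W′ u v = weight G b u v * χ (flip p S u xor flip p S v)
      W  u v = weight G b u v * χ (S u xor S v)
      neg : ∀ x → - x ≡ (- 1ℚ) * x
      neg = solve 1 (λ x → :- x := con (- 1ℚ) :* x) refl
      factor : ∀ w x y → w * x + (- 1ℚ) * (w * y) ≡ w * (x - y)
      factor = solve 3 (λ w x y → w :* x :+ con (- 1ℚ) :* (w :* y) := w :* (x :- y)) refl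
    local : ∀ u v → δ u v ≡ unit p u * g v + unit p v * g u
    local u v with p ≟ u | p ≟ v
    ... | no _ | no _ = trans (cong (weight G b u v *_) (ℚ.+-inverseʳ (χ (S u xor S v)))) (vanish (weight G b u v) (g v) (g u))
      where
      vanish : ∀ w x y → w * 0ℚ ≡ 0ℚ * x + 0ℚ * y
      vanish = solve 3 (λ w x y → w :* con 0ℚ := con 0ℚ :* x :+ con 0ℚ :* y) refl
    ... | yes refl | no _ = trans (cong (weight G b p v *_) (change (S p) (S v))) (arrange (weight G b p v) (sg (S p)) (sg (S v)) (g p))
      where
      change : ∀ s t → χ (not s xor t) - χ (s xor t) ≡ sg s * sg t
      change true  true  = refl
      change true  false = refl
      change false true  = refl
      change false false = refl
      arrange : ∀ w s t y → w * (s * t) ≡ 1ℚ * (s * (w * t)) + 0ℚ * y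
      arrange = solve 4 (λ w s t y → w :* (s :* t) := con 1ℚ :* (s :* (w :* t)) :+ con 0ℚ :* y) refl
    ... | no _ | yes refl = trans (cong₂ _*_ (weight-sym u p) (change (S u) (S p))) (arrange (weight G b p u) (sg (S p)) (sg (S u)) (g p))
      where
      change : ∀ s t → χ (s xor not t) - χ (s xor t) ≡ sg t * sg s
      change true  true  = refl
      change true  false = refl
      change false true  = refl
      change false false = refl
      arrange : ∀ w s t y → w * (s * t) ≡ 0ℚ * y + 1ℚ * (s * (w * t))
      arrange = solve 4 (λ w s t y → w :* (s :* t) := con 0ℚ :* y :+ con 1ℚ :* (s :* (w :* t))) refl
    ... | yes refl | yes refl = trans (cong (_* (χ (not (S p) xor not (S p)) - χ (S p xor S p))) (weight-diag p))
                                  (trans (vanish (χ (not (S p) xor not (S p)) - χ (S p xor S p)) (sg (S p)) (sg (S p)))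
                                         (sym (cong (λ w → 1ℚ * (sg (S p) * (w * sg (S p))) + 1ℚ * (sg (S p) * (w * sg (S p)))) (weight-diag p))))
      where
      vanish : ∀ x s t → 0ℚ * x ≡ 1ℚ * (s * (0ℚ * t)) + 1ℚ * (s * (0ℚ * t))
      vanish = solve 3 (λ x s t → con 0ℚ :* x := con 1ℚ :* (s :* (con 0ℚ :* t)) :+ con 1ℚ :* (s :* (con 0ℚ :* t))) refl
    halve : ∀ {x y} → x + x ≡ y + y → x ≡ y
    halve {x} {y} h = begin
      x            ≡⟨ solve 2 (λ x y → x := (x :- y) :+ y) refl x y ⟩
      (x - y) + y  ≡⟨ cong (_+ y) (2*-cancel (x - y) (begin
        2ℚ * (x - y)            ≡⟨ solve 2 (λ x y → con 2ℚ :* (x :- y) := (x :+ x) :- (y :+ y)) refl x y ⟩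
        (x + x) - (y + y)       ≡⟨ cong (_- (y + y)) h ⟩
        (y + y) - (y + y)       ≡⟨ ℚ.+-inverseʳ (y + y) ⟩
        0ℚ                      ∎)) ⟩
      0ℚ + y       ≡⟨ ℚ.+-identityˡ y ⟩
      y            ∎

x-y≡0⇒x≡y : ∀ x y → x - y ≡ 0ℚ → x ≡ y
x-y≡0⇒x≡y x y h = begin
  x            ≡⟨ solve 2 (λ x y → x := (x :- y) :+ y) refl x y ⟩
  (x - y) + y  ≡⟨ cong (_+ y) h ⟩
  0ℚ + y       ≡⟨ ℚ.+-identityˡ y ⟩
  y            ∎

private
  solve-for-z : ∀ x y z → x - y * z ≡ 0ℚ → x ≡ 0ℚ → y * z ≡ 0ℚ
  solve-for-z x y z h x≡0 = begin
    y * z                ≡⟨ solve 3 (λ x y z → y :* z := x :- (x :- y :* z)) refl x y z ⟩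
    x - (x - y * z)      ≡⟨ cong₂ _-_ x≡0 h ⟩
    0ℚ                   ∎

  remainder-zero : ∀ x y → x + (- 1ℚ) * y ≡ 0ℚ → x ≡ y
  remainder-zero x y h = x-y≡0⇒x≡y x y (trans (sym (solve 2 (λ x y → x :+ con (- 1ℚ) :* y := x :- y) refl x y)) h)

  zero-remainder : ∀ t → 0ℚ + (- 1ℚ) * (t * 0ℚ) ≡ 0ℚ
  zero-remainder = solve 1 (λ t → con 0ℚ :+ con (- 1ℚ) :* (t :* con 0ℚ) := con 0ℚ) refl

  quotient : ∀ q s → s ≢ 0ℚ → ℚ
  quotient q s s≢0 = q * (1/ s) {{≢-nonZero s≢0}}

  quotient-remainder : ∀ q s (s≢0 : s ≢ 0ℚ) → q + (- 1ℚ) * (quotient q s s≢0 * s) ≡ 0ℚ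
  quotient-remainder q s s≢0 = begin
    q + (- 1ℚ) * (q * 1/ s * s)    ≡⟨ cong (λ y → q + (- 1ℚ) * y) (ℚ.*-assoc q (1/ s) s) ⟩
    q + (- 1ℚ) * (q * (1/ s * s))  ≡⟨ cong (λ y → q + (- 1ℚ) * (q * y)) (ℚ.*-inverseˡ s) ⟩
    q + (- 1ℚ) * (q * 1ℚ)          ≡⟨ solve 1 (λ q → q :+ con (- 1ℚ) :* (q :* con 1ℚ) := con 0ℚ) refl q ⟩
    0ℚ                             ∎
    where instance _ = ≢-nonZero s≢0

≡0-stable : ∀ x → ¬ (x ≢ 0ℚ) → x ≡ 0ℚ
≡0-stable x = decidable-stable (x ℚ.≟ 0ℚ)

private
  ∅ : ∀ {N} → Subset N
  ∅ _ = false

cancel-2sg : ∀ s x → 2ℚ * sg s * x ≡ 0ℚ → x ≡ 0ℚ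
cancel-2sg s x h = sg-cancel s x (2*-cancel (sg s * x) (trans (sym (ℚ.*-assoc 2ℚ (sg s) x)) h))

linear-vanish : ∀ {N K} (c : Fin K → ℚ) (κ : Fin K → Fin N) z S →
                ∑ (λ k → c k * sg (S (κ k))) ≡ 0ℚ → ∑ (λ k → c k * sg (flip z S (κ k))) ≡ 0ℚ →
                ∑ (λ k → c k * unit z (κ k)) ≡ 0ℚ
linear-vanish c κ z S h h′ =
  cancel-2sg (S z) C (solve-for-z (∑ (λ k → c k * sg (S (κ k)))) (2ℚ * sg (S z)) C (trans (sym (linear-flip c κ z S)) h′) h)
  where
  C : ℚ
  C = ∑ (λ k → c k * unit z (κ k))

∑-unit : ∀ {N} (c : Fin N → ℚ) z → ∑ (λ k → c k * unit z k) ≡ c z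
∑-unit c z = trans (∑-cong λ k → ℚ.*-comm (c k) (unit z k)) (⟨unit,⟩ z c)

module _ {N} (G : Graph N) (b : PairVec N) (b0 : ℚ) where

  -- When a node can change sides without violating the equation, the left side of `cut-flip` is
  -- zero and the row of that node becomes a linear relation between signs.
  flip-vanish : ∀ p S → b · cutVec G S ≡ b0 → b · cutVec G (flip p S) ≡ b0 → ∑ (λ q → weight G b p q * sg (S q)) ≡ 0ℚ
  flip-vanish p S h h′ = sg-cancel (S p) (∑ (λ q → weight G b p q * sg (S q)))
    (trans (sym (cut-flip G b p S)) (trans (cong₂ _-_ h′ h) (ℚ.+-inverseʳ b0)))

  -- The cut polytope is full dimensional.
  constant-on-cuts : (∀ S → b · cutVec G S ≡ b0) → ∀ p q → weight G b p q ≡ 0ℚ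
  constant-on-cuts h p q = trans (sym (∑-unit (weight G b p) q))
    (linear-vanish (weight G b p) id q ∅ (row ∅) (row (flip q ∅)))
    where
    row : ∀ S → ∑ (λ q → weight G b p q * sg (S q)) ≡ 0ℚ
    row S = flip-vanish p S (h S) (h (flip p S))

  constant-on-cuts-edge : (∀ S → b · cutVec G S ≡ b0) → ∀ {u v} → toℕ u <ℕ toℕ v → adj G u v ≡ true → b u v ≡ 0ℚ
  constant-on-cuts-edge h {u} {v} u<v e = trans (sym (coord-< b u<v)) (trans (sym (weight-edge G b e)) (constant-on-cuts h u v))

  zero-weight-·cut : (∀ p q → weight G b p q ≡ 0ℚ) → ∀ S → b · cutVec G S ≡ 0ℚ
  zero-weight-·cut w≡0 S = trans (cut-weight G b S)
    (∑pairs-zero λ u v _ → trans (cong (_* χ (S u xor S v)) (w≡0 u v)) (ℚ.*-zeroˡ (χ (S u xor S v))))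

  constant-on-cuts-const : (∀ S → b · cutVec G S ≡ b0) → b0 ≡ 0ℚ
  constant-on-cuts-const h = trans (sym (h ∅)) (zero-weight-·cut (constant-on-cuts h) ∅)

-- Affine functions of pair vectors

module _ {n : ℕ} where

  -- Stated extensionally, so that closure properties build the functions used later without
  -- displaying their coefficients.
  Affine : (PairVec n → ℚ) → Set
  Affine Q = ∃ λ b → ∃ λ b0 → ∀ x → Q x ≡ b · x - b0

  affine-≗ : ∀ {Q R : PairVec n → ℚ} → (∀ x → Q x ≡ R x) → Affine R → Affine Q
  affine-≗ h (b , b0 , eq) = b , b0 , λ x → trans (h x) (eq x)

  affine-const : ∀ c → Affine (λ _ → c)
  affine-const c = (λ _ _ → 0ℚ) , - c , λ x → begin
    c            ≡⟨ solve 1 (λ c → c := con 0ℚ :- (:- c)) refl c ⟩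
    0ℚ - (- c)   ≡⟨ cong (_- (- c)) (∑pairs-zero λ u v _ → ℚ.*-zeroˡ (x u v)) ⟨
    (λ _ _ → 0ℚ) · x - (- c) ∎

  affine-+ : ∀ {Q R : PairVec n → ℚ} → Affine Q → Affine R → Affine (λ x → Q x + R x)
  affine-+ {Q} {R} (b , b0 , h) (c , c0 , k) = (λ u v → b u v + c u v) , b0 + c0 , λ x → begin
    Q x + R x                               ≡⟨ cong₂ _+_ (h x) (k x) ⟩
    (b · x - b0) + (c · x - c0)             ≡⟨ regroup (b · x) b0 (c · x) c0 ⟩
    (b · x + c · x) - (b0 + c0)             ≡⟨ cong (_- (b0 + c0)) (∑pairs-+ (λ u v → b u v * x u v) (λ u v → c u v * x u v)) ⟨
    ∑pairs (λ u v → b u v * x u v + c u v * x u v) - (b0 + c0)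
      ≡⟨ cong (_- (b0 + c0)) (∑pairs-cong λ u v _ → ℚ.*-distribʳ-+ (x u v) (b u v) (c u v)) ⟨
    (λ u v → b u v + c u v) · x - (b0 + c0) ∎
    where
    regroup : ∀ a b c d → (a - b) + (c - d) ≡ (a + c) - (b + d)
    regroup = solve 4 (λ a b c d → (a :- b) :+ (c :- d) := (a :+ c) :- (b :+ d)) refl

  affine-* : ∀ t {Q : PairVec n → ℚ} → Affine Q → Affine (λ x → t * Q x)
  affine-* t {Q} (b , b0 , h) = (λ u v → t * b u v) , t * b0 , λ x → begin
    t * Q x                                 ≡⟨ cong (t *_) (h x) ⟩
    t * (b · x - b0)                        ≡⟨ solve 3 (λ t a b → t :* (a :- b) := t :* a :- t :* b) refl t (b · x) b0 ⟩
    t * (b · x) - t * b0                    ≡⟨ cong (_- t * b0) (∑pairs-*ˡ t (λ u v → b u v * x u v)) ⟨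
    ∑pairs (λ u v → t * (b u v * x u v)) - t * b0
      ≡⟨ cong (_- t * b0) (∑pairs-cong λ u v _ → ℚ.*-assoc t (b u v) (x u v)) ⟨
    (λ u v → t * b u v) · x - t * b0        ∎

  affine-∑ : ∀ {K} {Q : Fin K → PairVec n → ℚ} → (∀ k → Affine (Q k)) → Affine (λ x → ∑ (λ k → Q k x))
  affine-∑ {zero}  h = affine-const 0ℚ
  affine-∑ {suc K} h = affine-+ (h zero) (affine-∑ (h ∘ suc))

  affine-∑pairs : ∀ {K} {Q : Fin K → Fin K → PairVec n → ℚ} → (∀ u v → Affine (Q u v)) → Affine (λ x → ∑pairs (λ u v → Q u v x))
  affine-∑pairs {Q = Q} h = affine-∑ λ u → affine-∑ λ v → guarded (toℕ u <ᵇ toℕ v) (h u v)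
    where
    guarded : ∀ b {R : PairVec n → ℚ} → Affine R → Affine (λ x → if b then R x else 0ℚ)
    guarded true  aff = aff
    guarded false aff = affine-const 0ℚ

  affine-coord : ∀ {u v} → u ≢ v → Affine (λ x → coord x u v)
  affine-coord {u} {v} u≢v = ≢-ordered (λ u v → Affine (λ x → coord x u v))
    (λ {u} {v} → affine-≗ λ x → coord-sym x v u) ordered-coord u≢v
    where
    ordered-coord : ∀ u v → toℕ u <ℕ toℕ v → Affine (λ x → coord x u v)
    ordered-coord u v u<v = e[ u , v ] , 0ℚ , λ x → begin
      coord x u v          ≡⟨ coord-< x u<v ⟩
      x u v                ≡⟨ ·-e x u<v ⟨
      x · e[ u , v ]       ≡⟨ ·-comm x e[ u , v ] ⟩
      e[ u , v ] · x       ≡⟨ ℚ.+-identityʳ (e[ u , v ] · x) ⟨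
      e[ u , v ] · x - 0ℚ  ∎

  -- An affine dependence between vectors passes to the values of any affine function; a well chosen
  -- function then isolates one coefficient of the dependence.
  affine-combination : ∀ {K} {Q : PairVec n → ℚ} → Affine Q → (c : Fin K → ℚ) (xs : Fin K → PairVec n) →
                       ∑ c ≡ 0ℚ → (∀ u v → toℕ u <ℕ toℕ v → ∑ (λ k → c k * xs k u v) ≡ 0ℚ) →
                       ∑ (λ k → c k * Q (xs k)) ≡ 0ℚ
  affine-combination {Q = Q} (b , b0 , h) c xs ∑c≡0 ∑cx≡0 = begin
    ∑ (λ k → c k * Q (xs k))
      ≡⟨ ∑-cong (λ k → trans (cong (c k *_) (h (xs k))) (expand (c k) (b · xs k) b0)) ⟩
    ∑ (λ k → c k * (b · xs k) + c k * (- b0))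
      ≡⟨ ∑-+ (λ k → c k * (b · xs k)) (λ k → c k * (- b0)) ⟩
    ∑ (λ k → c k * (b · xs k)) + ∑ (λ k → c k * (- b0))
      ≡⟨ cong₂ _+_ (sym (·-comb b c xs)) (∑-*ʳ (- b0) c) ⟩
    b · (λ u v → ∑ (λ k → c k * xs k u v)) + ∑ c * (- b0)
      ≡⟨ cong₂ (λ s t → s + t * (- b0)) (∑pairs-zero λ u v u<v → trans (cong (b u v *_) (∑cx≡0 u v u<v)) (ℚ.*-zeroʳ (b u v))) ∑c≡0 ⟩
    0ℚ + 0ℚ * (- b0)
      ≡⟨ solve 1 (λ b → con 0ℚ :+ con 0ℚ :* b := con 0ℚ) refl (- b0) ⟩
    0ℚ ∎
    where
    expand : ∀ c x y → c * (x - y) ≡ c * x + c * (- y)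
    expand = solve 3 (λ c x y → c :* (x :- y) := c :* x :+ c :* (:- y)) refl

  Cut : Subset n → PairVec n
  Cut = cutVec (K n)

  K-adj : ∀ {u v : Fin n} → u ≢ v → adj (K n) u v ≡ true
  K-adj u≢v = cong not (⌊≟⌋-≢ u≢v)

  coord-Cut : ∀ S {u v} → u ≢ v → coord (Cut S) u v ≡ χ (S u xor S v)
  coord-Cut S = ≢-ordered (λ u v → coord (Cut S) u v ≡ χ (S u xor S v))
    (λ {u} {v} h → trans (coord-sym (Cut S) v u) (trans h (cong χ (xor-comm (S u) (S v)))))
    (λ u v u<v → trans (coord-< (Cut S) u<v) (cong (λ e → if e ∧ (S u xor S v) then 1ℚ else 0ℚ) (K-adj (distinct u<v))))

  -- Cuts of the complete graph affinely span the whole space. Identities are wanted for all vectors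
  -- because `IsTriangle` quantifies over them, and because coefficients are read off at unit
  -- vectors, which need not be cuts.
  affine-vanish : ∀ {Q : PairVec n → ℚ} → Affine Q → (∀ S → Q (Cut S) ≡ 0ℚ) → ∀ x → Q x ≡ 0ℚ
  affine-vanish {Q} (b , b0 , h) zero-on-cuts x = begin
    Q x           ≡⟨ h x ⟩
    b · x - b0    ≡⟨ cong₂ _-_ (∑pairs-zero λ u v u<v → trans (cong (_* x u v) (constant-on-cuts-edge (K n) b b0 const u<v (K-adj (distinct u<v)))) (ℚ.*-zeroˡ (x u v)))
                               (constant-on-cuts-const (K n) b b0 const) ⟩
    0ℚ            ∎
    where
    const : ∀ S → b · Cut S ≡ b0
    const S = x-y≡0⇒x≡y (b · Cut S) b0 (trans (sym (h (Cut S))) (zero-on-cuts S))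

  -- Affine functions that vanish on a facet

  module Facet (a : PairVec n) (a0 : ℚ) (facet : FacetInducing (K n) a a0) where

    slack : PairVec n → ℚ
    slack x = a0 - a · x

    affine-slack : Affine slack
    affine-slack = affine-≗ (λ x → solve 2 (λ a0 ax → a0 :- ax := con (- 1ℚ) :* (ax :- a0)) refl a0 (a · x))
                            (affine-* (- 1ℚ) (a , a0 , λ x → refl))

    private
      S₀ : Subset n
      S₀ = proj₁ (proj₁ (proj₂ (proj₂ facet)))

      slack-S₀ : slack (Cut S₀) ≢ 0ℚ
      slack-S₀ h = proj₂ (proj₁ (proj₂ (proj₂ facet))) (sym (x-y≡0⇒x≡y a0 (a · Cut S₀) h))

      d : ℕ
      d = proj₁ (proj₂ (proj₂ (proj₂ facet)))

      no-more : ¬ (Σ (Fin (suc (suc d)) → Subset n) λ Ss → AffInd (λ i → Cut (Ss i)))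
      no-more = proj₁ (proj₂ (proj₂ (proj₂ (proj₂ facet))))

      roots : Fin d → Subset n
      roots = proj₁ (proj₂ (proj₂ (proj₂ (proj₂ (proj₂ facet)))))

      roots-tight : ∀ i → a · Cut (roots i) ≡ a0
      roots-tight = proj₁ (proj₂ (proj₂ (proj₂ (proj₂ (proj₂ (proj₂ facet))))))

      roots-ind : AffInd (λ i → Cut (roots i))
      roots-ind = proj₂ (proj₂ (proj₂ (proj₂ (proj₂ (proj₂ (proj₂ facet))))))

    slack-nonneg : ∀ S → 0ℚ ≤ slack (Cut S)
    slack-nonneg S = subst (_≤ slack (Cut S)) (ℚ.+-inverseʳ (a · Cut S)) (ℚ.+-monoˡ-≤ (- (a · Cut S)) (proj₁ (proj₂ facet) S))

    slack-root : ∀ S → a · Cut S ≡ a0 → slack (Cut S) ≡ 0ℚ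
    slack-root S h = trans (cong (λ y → a0 - y) h) (ℚ.+-inverseʳ a0)

    private
      extended : Subset n → Fin (suc (suc d)) → Subset n
      extended S zero          = S
      extended S (suc zero)    = S₀
      extended S (suc (suc i)) = roots i

      drop₂ : ∀ x {y z} → y ≡ 0ℚ → z ≡ 0ℚ → x + (y + z) ≡ x
      drop₂ x refl refl = ℚ.+-identityʳ x

      drop-head : ∀ {x} y {z} → x ≡ 0ℚ → z ≡ 0ℚ → x + (y + z) ≡ y
      drop-head y refl refl = trans (ℚ.+-identityˡ (y + 0ℚ)) (ℚ.+-identityʳ y)

      drop-heads : ∀ {x y} z → x ≡ 0ℚ → y ≡ 0ℚ → x + (y + z) ≡ z
      drop-heads z refl refl = trans (ℚ.+-identityˡ (0ℚ + z)) (ℚ.+-identityˡ z)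

      annihilate : ∀ {x} y → x ≡ 0ℚ → x * y ≡ 0ℚ
      annihilate y refl = ℚ.*-zeroˡ y

      annihilateʳ : ∀ x {y} → y ≡ 0ℚ → x * y ≡ 0ℚ
      annihilateʳ x refl = ℚ.*-zeroʳ x

      -- The coefficients drop out in turn: among these cuts `R` is nonzero only at `S`, then
      -- `slack` only at `S₀`, and what remains is the independence of the roots.
      extended-ind : ∀ {R : PairVec n → ℚ} → Affine R → (∀ i → R (Cut (roots i)) ≡ 0ℚ) → R (Cut S₀) ≡ 0ℚ →
                     ∀ S → R (Cut S) ≢ 0ℚ → AffInd (λ i → Cut (extended S i))
      extended-ind {R} affR R-roots R-S₀ S R-S≢0 c ∑c≡0 ∑cx≡0 =
        λ { zero → c₀ ; (suc zero) → c₁ ; (suc (suc i)) → c₂ i }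
        where
        c₀ : c zero ≡ 0ℚ
        c₀ = *-≢0 (trans (sym (drop₂ (c zero * R (Cut S)) (annihilateʳ (c (suc zero)) R-S₀)
                                (∑-zero λ i → annihilateʳ (c (suc (suc i))) (R-roots i))))
                         (affine-combination affR c (λ i → Cut (extended S i)) ∑c≡0 ∑cx≡0)) R-S≢0
        c₁ : c (suc zero) ≡ 0ℚ
        c₁ = *-≢0 (trans (sym (drop-head (c (suc zero) * slack (Cut S₀)) (annihilate (slack (Cut S)) c₀)
                                (∑-zero λ i → annihilateʳ (c (suc (suc i))) (slack-root (roots i) (roots-tight i)))))
                         (affine-combination affine-slack c (λ i → Cut (extended S i)) ∑c≡0 ∑cx≡0)) slack-S₀
        c₂ : ∀ i → c (suc (suc i)) ≡ 0ℚ
        c₂ = roots-ind (λ i → c (suc (suc i)))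
          (trans (sym (drop-heads (∑ (λ i → c (suc (suc i)))) c₀ c₁)) ∑c≡0)
          (λ u v u<v → trans (sym (drop-heads (∑ (λ i → c (suc (suc i)) * Cut (roots i) u v))
                                     (annihilate (Cut S u v) c₀) (annihilate (Cut S₀ u v) c₁))) (∑cx≡0 u v u<v))

    -- Otherwise a cut with Q - t slack ≠ 0, a cut off the face and the d roots would be affinely independent.
    multiple-of-slack : ∀ {Q : PairVec n → ℚ} → Affine Q → (∀ S → a · Cut S ≡ a0 → Q (Cut S) ≡ 0ℚ) →
                        ∃ λ t → ∀ x → Q x ≡ t * slack x
    multiple-of-slack {Q} affQ Q-roots = t , λ x → remainder-zero (Q x) (t * slack x) (affine-vanish affR R-cuts x)
      where
      -- This ratio makes the remainder `R` vanish at `S₀` as well as at the roots.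
      t : ℚ
      t = quotient (Q (Cut S₀)) (slack (Cut S₀)) slack-S₀
      R : PairVec n → ℚ
      R x = Q x + (- 1ℚ) * (t * slack x)
      affR : Affine R
      affR = affine-+ affQ (affine-* (- 1ℚ) (affine-* t affine-slack))
      R-roots : ∀ i → R (Cut (roots i)) ≡ 0ℚ
      R-roots i = trans (cong₂ (λ x y → x + (- 1ℚ) * (t * y)) (Q-roots (roots i) (roots-tight i)) (slack-root (roots i) (roots-tight i)))
                        (zero-remainder t)
      R-S₀ : R (Cut S₀) ≡ 0ℚ
      R-S₀ = quotient-remainder (Q (Cut S₀)) (slack (Cut S₀)) slack-S₀
      R-cuts : ∀ S → R (Cut S) ≡ 0ℚ
      R-cuts S = ≡0-stable (R (Cut S)) λ ne → no-more (extended S , extended-ind affR R-roots R-S₀ S ne)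

-- Facets of the complete graph that are not triangle inequalities

4ℚ : ℚ
4ℚ = 2ℚ * 2ℚ

module _ {n : ℕ} where

  -- The affine expression for the product of two signs. On the diagonal it is 1, the square of a
  -- sign, so that `signs-Cut` holds for all i and j; the products formed later do meet equal
  -- indices.
  signs : Fin n → Fin n → PairVec n → ℚ
  signs i j x = if ⌊ i ≟ j ⌋ then 1ℚ else 1ℚ - 2ℚ * coord x i j

  signs-≢ : ∀ {i j} → i ≢ j → ∀ x → signs i j x ≡ 1ℚ - 2ℚ * coord x i j
  signs-≢ {i} {j} ne x = cong (λ b → if b then 1ℚ else 1ℚ - 2ℚ * coord x i j) (⌊≟⌋-≢ ne)

  affine-signs : ∀ i j → Affine (signs i j)
  affine-signs i j with i ≟ j
  ... | yes _   = affine-const 1ℚ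
  ... | no i≢j = affine-≗ (λ x → solve 1 (λ x → con 1ℚ :- con 2ℚ :* x := con 1ℚ :+ con (- 2ℚ) :* x) refl (coord x i j))
                   (affine-+ (affine-const 1ℚ) (affine-* (- 2ℚ) (affine-coord i≢j)))

  signs-Cut : ∀ i j S → signs i j (Cut S) ≡ sg (S i) * sg (S j)
  signs-Cut i j S = by-cases (i ≟ j)
    where
    by-cases : Dec (i ≡ j) → signs i j (Cut S) ≡ sg (S i) * sg (S j)
    by-cases (yes refl) = trans (cong (λ b → if b then 1ℚ else 1ℚ - 2ℚ * coord (Cut S) i i) (⌊≟⌋-refl i)) (sym (sg-square (S i)))
    by-cases (no i≢j)   = trans (signs-≢ i≢j (Cut S)) (trans (cong (λ c → 1ℚ - 2ℚ * c) (coord-Cut S i≢j)) (sg-χ (S i) (S j)))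

-- The factor σ_p + ε σ_q switches off the cuts on which the relation fails. A condition on some
-- roots thus becomes an equation on all of them.
agree-or-zero : ∀ p q e → (p xor q ≡ e) ⊎ (sg p + sg e * sg q ≡ 0ℚ)
agree-or-zero true  true  true  = inj₂ refl
agree-or-zero true  true  false = inj₁ refl
agree-or-zero true  false true  = inj₁ refl
agree-or-zero true  false false = inj₂ refl
agree-or-zero false true  true  = inj₁ refl
agree-or-zero false true  false = inj₂ refl
agree-or-zero false false true  = inj₂ refl
agree-or-zero false false false = inj₁ refl

private
  agree : ∀ p q {e} → p xor q ≡ e → sg p + sg e * sg q ≡ 2ℚ * sg p
  agree true  true  refl = refl
  agree true  false refl = refl
  agree false true  refl = refl
  agree false false refl = refl

  triangleForm : Bool → Bool → Form
  triangleForm false true  = f-uv∣w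
  triangleForm false false = f-uvw
  triangleForm true  false = f-uw∣v
  triangleForm true  true  = f-wv∣u

  square-nonneg : ∀ t → 0ℚ ≤ t * t
  square-nonneg t with ℚ.≤-total 0ℚ t
  ... | inj₁ 0≤t = subst (_≤ t * t) (ℚ.*-zeroʳ t) (ℚ.*-monoˡ-≤-nonNeg t {{nonNegative 0≤t}} 0≤t)
  ... | inj₂ t≤0 = subst (_≤ t * t) (ℚ.*-zeroʳ t) (ℚ.*-monoˡ-≤-nonPos t {{nonPositive t≤0}} t≤0)

  *-nonneg : ∀ s t → 0ℚ ≤ s → 0ℚ ≤ t → 0ℚ ≤ s * t
  *-nonneg s t 0≤s 0≤t = subst (_≤ s * t) (ℚ.*-zeroʳ s) (ℚ.*-monoˡ-≤-nonNeg s {{nonNegative 0≤s}} 0≤t)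

  -- Multiplied by t, the equation has the nonnegative left side t² w and a negative right side. The
  -- sign of t itself never enters.
  opposite-signs : ∀ t C w g → 0ℚ ≤ w → t * w ≡ - (4ℚ * (g * C)) → 0ℚ < g * (t * C) → ⊥
  opposite-signs t C w g 0≤w tw 0<gtC = ℚ.<-irrefl refl (ℚ.<-≤-trans (ℚ.*-monoʳ-<-pos 4ℚ 0<gtC) 4gtC≤0)
    where
    eq : t * t * w ≡ - (4ℚ * (g * (t * C)))
    eq = begin
      t * t * w                 ≡⟨ ℚ.*-assoc t t w ⟩
      t * (t * w)               ≡⟨ cong (t *_) tw ⟩
      t * (- (4ℚ * (g * C)))    ≡⟨ solve 4 (λ t g C f → t :* (:- (f :* (g :* C))) := :- (f :* (g :* (t :* C)))) refl t g C 4ℚ ⟩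
      - (4ℚ * (g * (t * C)))    ∎
    4gtC≤0 : 4ℚ * (g * (t * C)) ≤ 4ℚ * 0ℚ
    4gtC≤0 = subst (_≤ 0ℚ) (solve 1 (λ x → :- (:- x) := x) refl (4ℚ * (g * (t * C))))
               (ℚ.neg-antimono-≤ (subst (0ℚ ≤_) eq (*-nonneg (t * t) w (square-nonneg t) 0≤w)))

  sign-of : ∀ x → x ≢ 0ℚ → ∃ λ s → 0ℚ < sg s * x
  sign-of x x≢0 with ℚ.<-cmp 0ℚ x
  ... | tri< 0<x _ _ = false , subst (0ℚ <_) (sym (ℚ.*-identityˡ x)) 0<x
  ... | tri≈ _ 0≡x _ = ⊥-elim (x≢0 (sym 0≡x))
  ... | tri> _ _ x<0 = true , subst (0ℚ <_) (solve 1 (λ x → :- x := con (- 1ℚ) :* x) refl x) (ℚ.neg-antimono-< x<0)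

  factor : ∀ e s p q r → 1ℚ + e * (p * q) + s * (p * r) + e * s * (q * r) - (1ℚ - p * p) ≡ (p + e * q) * (p + s * r)
  factor = solve 5 (λ e s p q r → con 1ℚ :+ e :* (p :* q) :+ s :* (p :* r) :+ e :* s :* (q :* r) :- (con 1ℚ :- p :* p)
                                    := (p :+ e :* q) :* (p :+ s :* r)) refl

  factor-positive : ∀ t k → t * k ≡ 4ℚ → 0ℚ ≤ k → 0ℚ < k
  factor-positive t k tk≡4 0≤k with ℚ.<-cmp 0ℚ k
  ... | tri< 0<k _ _ = 0<k
  ... | tri≈ _ 0≡k _ = ⊥-elim (4≢0 (trans (sym tk≡4) (trans (cong (t *_) (sym 0≡k)) (ℚ.*-zeroʳ t))))
    where
    4≢0 : 4ℚ ≢ 0ℚ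
    4≢0 ()
  ... | tri> _ _ k<0 = ⊥-elim (ℚ.<-irrefl refl (ℚ.<-≤-trans k<0 0≤k))

  -- Since t k = 4, the number k / 4 serves as the inverse of t, and its sign is known when k is a
  -- slack.
  collect : ∀ a0 ax t k D Tri → Tri ≡ t * (a0 - ax) → t * k ≡ 4ℚ → Tri ≡ - (2ℚ * D) → ax - a0 ≡ ½ * k * D
  collect a0 ax t k D Tri Tri≡ tk Tri≡′ = begin
    ax - a0                              ≡⟨ solve 2 (λ a0 ax → ax :- a0 := con (- (½ * ½)) :* (con 4ℚ :* (a0 :- ax))) refl a0 ax ⟩
    - (½ * ½) * (4ℚ * (a0 - ax))         ≡⟨ cong (λ f → - (½ * ½) * (f * (a0 - ax))) tk ⟨
    - (½ * ½) * (t * k * (a0 - ax))      ≡⟨ solve 3 (λ t k w → con (- (½ * ½)) :* (t :* k :* w) := con (- (½ * ½)) :* k :* (t :* w)) refl t k (a0 - ax) ⟩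
    - (½ * ½) * k * (t * (a0 - ax))      ≡⟨ cong (- (½ * ½) * k *_) (trans (sym Tri≡) Tri≡′) ⟩
    - (½ * ½) * k * (- (2ℚ * D))         ≡⟨ solve 2 (λ k D → con (- (½ * ½)) :* k :* (:- (con 2ℚ :* D)) := con ½ :* k :* D) refl k D ⟩
    ½ * k * D                            ∎

module NonTriangle {n : ℕ} (a : PairVec n) (a0 : ℚ) (facet : FacetInducing (K n) a a0) (nontriangle : ¬ IsTriangle a a0) where

  open Facet a a0 facet

  private module Triangle {u v z : Fin n} (u≢v : u ≢ v) (u≢z : u ≢ z) (v≢z : v ≢ z) (e s : Bool) where

    -- The product (σ_u + ε σ_v)(σ_u + s σ_z), expanded with σ_u² = 1, which makes it affine in the
    -- cut vector. The four choices of signs give the four triangle inequalities on u, v, z, up to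
    -- the factor -2.
    Tri : PairVec n → ℚ
    Tri x = 1ℚ + sg e * signs u v x + sg s * signs u z x + sg e * sg s * signs v z x

    affine-Tri : Affine Tri
    affine-Tri = affine-+ (affine-+ (affine-+ (affine-const 1ℚ) (affine-* (sg e) (affine-signs u v)))
                                  (affine-* (sg s) (affine-signs u z)))
                        (affine-* (sg e * sg s) (affine-signs v z))

    Tri-Cut : ∀ S → Tri (Cut S) ≡ (sg (S u) + sg e * sg (S v)) * (sg (S u) + sg s * sg (S z))
    Tri-Cut S = begin
      Tri (Cut S)
        ≡⟨ cong₂ _+_ (cong₂ (λ p q → 1ℚ + sg e * p + sg s * q) (signs-Cut u v S) (signs-Cut u z S)) (cong (sg e * sg s *_) (signs-Cut v z S)) ⟩
      W                             ≡⟨ ℚ.+-identityʳ W ⟨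
      W - (1ℚ - 1ℚ)                 ≡⟨ cong (λ o → W - (1ℚ - o)) (sg-square (S u)) ⟨
      W - (1ℚ - sg (S u) * sg (S u))
        ≡⟨ factor (sg e) (sg s) (sg (S u)) (sg (S v)) (sg (S z)) ⟩
      (sg (S u) + sg e * sg (S v)) * (sg (S u) + sg s * sg (S z)) ∎
      where
      W : ℚ
      W = 1ℚ + sg e * (sg (S u) * sg (S v)) + sg s * (sg (S u) * sg (S z)) + sg e * sg s * (sg (S v) * sg (S z))

    Tri-Δ : ∀ x → Tri x ≡ - (2ℚ * Δ (triangleForm e s) u v z x)
    Tri-Δ x = trans
      (cong₂ _+_ (cong₂ (λ p q → 1ℚ + sg e * p + sg s * q) (signs-≢ u≢v x) (signs-≢ u≢z x)) (cong (sg e * sg s *_) (signs-≢ v≢z x)))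
      (cases e s)
      where
      X Y Z : ℚ
      X = coord x u v
      Y = coord x u z
      Z = coord x v z
      cases : ∀ e s → 1ℚ + sg e * (1ℚ - 2ℚ * X) + sg s * (1ℚ - 2ℚ * Y) + sg e * sg s * (1ℚ - 2ℚ * Z)
                      ≡ - (2ℚ * Δ (triangleForm e s) u v z x)
      cases false true  = solve 3 (λ X Y Z → con 1ℚ :+ con 1ℚ :* (con 1ℚ :- con 2ℚ :* X) :+ con (- 1ℚ) :* (con 1ℚ :- con 2ℚ :* Y)
                                               :+ con 1ℚ :* con (- 1ℚ) :* (con 1ℚ :- con 2ℚ :* Z)
                                             := :- (con 2ℚ :* (X :- Y :- Z))) refl X Y Z
      cases false false = solve 3 (λ X Y Z → con 1ℚ :+ con 1ℚ :* (con 1ℚ :- con 2ℚ :* X) :+ con 1ℚ :* (con 1ℚ :- con 2ℚ :* Y)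
                                               :+ con 1ℚ :* con 1ℚ :* (con 1ℚ :- con 2ℚ :* Z)
                                             := :- (con 2ℚ :* (X :+ Y :+ Z :- con 2ℚ))) refl X Y Z
      cases true  false = trans (solve 3 (λ X Y Z → con 1ℚ :+ con (- 1ℚ) :* (con 1ℚ :- con 2ℚ :* X) :+ con 1ℚ :* (con 1ℚ :- con 2ℚ :* Y)
                                               :+ con (- 1ℚ) :* con 1ℚ :* (con 1ℚ :- con 2ℚ :* Z)
                                             := :- (con 2ℚ :* (Y :- X :- Z))) refl X Y Z)
                                (cong (λ Z → - (2ℚ * (Y - X - Z))) (coord-sym x v z))
      cases true  true  = trans (solve 3 (λ X Y Z → con 1ℚ :+ con (- 1ℚ) :* (con 1ℚ :- con 2ℚ :* X) :+ con (- 1ℚ) :* (con 1ℚ :- con 2ℚ :* Y)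
                                               :+ con (- 1ℚ) :* con (- 1ℚ) :* (con 1ℚ :- con 2ℚ :* Z)
                                             := :- (con 2ℚ :* (Z :- Y :- X))) refl X Y Z)
                                (trans (cong (λ X → - (2ℚ * (Z - Y - X))) (coord-sym x u v))
                                       (cong₂ (λ Z Y → - (2ℚ * (Z - Y - coord x v u))) (coord-sym x v z) (coord-sym x u z)))

    -- A cut at which both factors of `Tri` are 2. If `Tri` is a multiple of the slack, the value 4
    -- here shows that the multiple is positive.
    corner : Subset n
    corner q = (⌊ v ≟ q ⌋ ∧ e) xor (⌊ z ≟ q ⌋ ∧ s)

    corner-u : corner u ≡ false
    corner-u = cong₂ (λ p q → (p ∧ e) xor (q ∧ s)) (⌊≟⌋-≢ (u≢v ∘ sym)) (⌊≟⌋-≢ (u≢z ∘ sym))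

    corner-v : corner v ≡ e
    corner-v = trans (cong₂ (λ p q → (p ∧ e) xor (q ∧ s)) (⌊≟⌋-refl v) (⌊≟⌋-≢ (v≢z ∘ sym))) (xor-comm e false)

    corner-z : corner z ≡ s
    corner-z = cong₂ (λ p q → (p ∧ e) xor (q ∧ s)) (⌊≟⌋-≢ v≢z) (⌊≟⌋-refl z)

    Tri-corner : Tri (Cut corner) ≡ 4ℚ
    Tri-corner = begin
      Tri (Cut corner)                                                    ≡⟨ Tri-Cut corner ⟩
      (sg (corner u) + sg e * sg (corner v)) * (sg (corner u) + sg s * sg (corner z))
        ≡⟨ cong₂ _*_ (cong₂ (λ p q → sg p + sg e * sg q) corner-u corner-v) (cong₂ (λ p q → sg p + sg s * sg q) corner-u corner-z) ⟩
      (1ℚ + sg e * sg e) * (1ℚ + sg s * sg s)                           ≡⟨ cong₂ (λ p q → (1ℚ + p) * (1ℚ + q)) (sg-square e) (sg-square s) ⟩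
      4ℚ                                                                ∎

    Tri-not-tight : ¬ (∀ S → a · Cut S ≡ a0 → Tri (Cut S) ≡ 0ℚ)
    Tri-not-tight Tri-roots = nontriangle
      (½ * k , 0<½k , u , v , z , u≢v , u≢z , v≢z , triangleForm e s , identity)
      where
      t : ℚ
      t = proj₁ (multiple-of-slack affine-Tri Tri-roots)
      Tri≡ : ∀ x → Tri x ≡ t * slack x
      Tri≡ = proj₂ (multiple-of-slack affine-Tri Tri-roots)
      k : ℚ
      k = slack (Cut corner)
      tk≡4 : t * k ≡ 4ℚ
      tk≡4 = trans (sym (Tri≡ (Cut corner))) Tri-corner
      0<½k : 0ℚ < ½ * k
      0<½k = ℚ.*-monoʳ-<-pos ½ (factor-positive t k tk≡4 (slack-nonneg corner))
      identity : ∀ x → a · x - a0 ≡ ½ * k * Δ (triangleForm e s) u v z x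
      identity x = collect a0 (a · x) t k (Δ (triangleForm e s) u v z x) (Tri x) (Tri≡ x) tk≡4 (Tri-Δ x)

  module _ {u v z : Fin n} (u≢v : u ≢ v) (u≢z : u ≢ z) (v≢z : v ≢ z) (e : Bool) {K} (c : Fin K → ℚ) (κ : Fin K → Fin n) where

    private
      L : Subset n → ℚ
      L S = ∑ (λ k → c k * sg (S (κ k)))

      C : ℚ
      C = ∑ (λ k → c k * unit z (κ k))

      -- The product (σ_u + ε σ_v) L(σ), affine in the cut vector because each of its terms is a
      -- product of two signs.
      Q : PairVec n → ℚ
      Q x = ∑ (λ k → c k * (signs u (κ k) x + sg e * signs v (κ k) x))

      affine-Q : Affine Q
      affine-Q = affine-∑ λ k → affine-* (c k) (affine-+ (affine-signs u (κ k)) (affine-* (sg e) (affine-signs v (κ k))))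

      Q-Cut : ∀ S → Q (Cut S) ≡ (sg (S u) + sg e * sg (S v)) * L S
      Q-Cut S = trans
        (∑-cong λ k → trans (cong₂ (λ p q → c k * (p + sg e * q)) (signs-Cut u (κ k) S) (signs-Cut v (κ k) S))
                            (regroup (c k) (sg e) (sg (S u)) (sg (S v)) (sg (S (κ k)))))
        (∑-*ˡ (sg (S u) + sg e * sg (S v)) (λ k → c k * sg (S (κ k))))
        where
        regroup : ∀ c e p q r → c * (p * r + e * (q * r)) ≡ (p + e * q) * (c * r)
        regroup = solve 5 (λ c e p q r → c :* (p :* r :+ e :* (q :* r)) := (p :+ e :* q) :* (c :* r)) refl

      Q-agree : ∀ S → S u xor S v ≡ e → Q (Cut S) ≡ 2ℚ * sg (S u) * L S
      Q-agree S h = trans (Q-Cut S) (cong (_* L S) (agree (S u) (S v) h))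

      flip-agree : ∀ S → S u xor S v ≡ e → flip z S u xor flip z S v ≡ e
      flip-agree S h = trans (cong₂ _xor_ (flip-other S (u≢z ∘ sym)) (flip-other S (v≢z ∘ sym))) h

      L-flip : ∀ S → L S ≡ 0ℚ → L (flip z S) ≡ 0ℚ - 2ℚ * sg (S z) * C
      L-flip S L≡0 = trans (linear-flip c κ z S) (cong (_- 2ℚ * sg (S z) * C) L≡0)

    coefficient-vanishes : (∀ S → a · Cut S ≡ a0 → S u xor S v ≡ e → ∑ (λ k → c k * sg (S (κ k))) ≡ 0ℚ) →
                           ∑ (λ k → c k * unit z (κ k)) ≡ 0ℚ
    coefficient-vanishes L-roots = ≡0-stable C λ C≢0 → contradiction C≢0
      where
      Q-roots : ∀ S → a · Cut S ≡ a0 → Q (Cut S) ≡ 0ℚ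
      Q-roots S root = trans (Q-Cut S) (by-cases (agree-or-zero (S u) (S v) e))
        where
        by-cases : (S u xor S v ≡ e) ⊎ (sg (S u) + sg e * sg (S v) ≡ 0ℚ) → (sg (S u) + sg e * sg (S v)) * L S ≡ 0ℚ
        by-cases (inj₁ h) = trans (cong ((sg (S u) + sg e * sg (S v)) *_) (L-roots S root h)) (ℚ.*-zeroʳ (sg (S u) + sg e * sg (S v)))
        by-cases (inj₂ h) = trans (cong (_* L S) h) (ℚ.*-zeroˡ (L S))
      t : ℚ
      t = proj₁ (multiple-of-slack affine-Q Q-roots)
      Q≡ : ∀ x → Q x ≡ t * slack x
      Q≡ = proj₂ (multiple-of-slack affine-Q Q-roots)
      -- Some cut with the prescribed relation between u and v. If t = 0, then `L` vanishes there
      -- and at its flip, and the difference of the two values reads off `C`.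
      S₁ : Subset n
      S₁ q = ⌊ v ≟ q ⌋ ∧ e
      S₁-agree : S₁ u xor S₁ v ≡ e
      S₁-agree = cong₂ (λ p q → (p ∧ e) xor (q ∧ e)) (⌊≟⌋-≢ (u≢v ∘ sym)) (⌊≟⌋-refl v)
      t≡0⇒C≡0 : t ≡ 0ℚ → C ≡ 0ℚ
      t≡0⇒C≡0 t≡0 = linear-vanish c κ z S₁ (L-zero S₁ S₁-agree) (L-zero (flip z S₁) (flip-agree S₁ S₁-agree))
        where
        L-zero : ∀ S → S u xor S v ≡ e → L S ≡ 0ℚ
        L-zero S h = cancel-2sg (S u) (L S) (trans (sym (Q-agree S h)) (trans (Q≡ (Cut S)) (trans (cong (_* slack (Cut S)) t≡0) (ℚ.*-zeroˡ (slack (Cut S))))))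
      contradiction : C ≢ 0ℚ → ⊥
      contradiction C≢0 = Tri-not-tight Tri-roots
        where
        tC≢0 : t * C ≢ 0ℚ
        tC≢0 tC≡0 = C≢0 (t≡0⇒C≡0 (*-≢0 tC≡0 C≢0))
        -- With the sign of t C chosen here, a root with σ_u = ε σ_v and with σ_u σ_z equal to this
        -- sign would be flipped at z into a cut of negative slack.
        s : Bool
        s = proj₁ (sign-of (t * C) tC≢0)
        0<stC : 0ℚ < sg s * (t * C)
        0<stC = proj₂ (sign-of (t * C) tC≢0)
        open Triangle u≢v u≢z v≢z e s
        no-root : ∀ S → a · Cut S ≡ a0 → S u xor S v ≡ e → S u xor S z ≡ s → ⊥
        no-root S root h k = opposite-signs t C (slack (Cut (flip z S))) (sg s) (slack-nonneg (flip z S)) (begin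
          t * slack (Cut (flip z S))                      ≡⟨ Q≡ (Cut (flip z S)) ⟨
          Q (Cut (flip z S))                              ≡⟨ Q-agree (flip z S) (flip-agree S h) ⟩
          2ℚ * sg (flip z S u) * L (flip z S)             ≡⟨ cong₂ (λ p q → 2ℚ * sg p * q) (flip-other S (u≢z ∘ sym)) (L-flip S (L-roots S root h)) ⟩
          2ℚ * sg (S u) * (0ℚ - 2ℚ * sg (S z) * C)        ≡⟨ collect-signs (sg (S u)) (sg (S z)) C ⟩
          - (4ℚ * (sg (S u) * sg (S z) * C))              ≡⟨ cong (λ g → - (4ℚ * (g * C))) (trans (sym (sg-xor (S u) (S z))) (cong sg k)) ⟩
          - (4ℚ * (sg s * C))                             ∎) 0<stC
          where
          collect-signs : ∀ p q C → 2ℚ * p * (0ℚ - 2ℚ * q * C) ≡ - (4ℚ * (p * q * C))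
          collect-signs = solve 3 (λ p q C → con 2ℚ :* p :* (con 0ℚ :- con 2ℚ :* q :* C) := :- (con 4ℚ :* (p :* q :* C))) refl
        Tri-roots : ∀ S → a · Cut S ≡ a0 → Tri (Cut S) ≡ 0ℚ
        Tri-roots S root = trans (Tri-Cut S) (by-cases (agree-or-zero (S u) (S v) e) (agree-or-zero (S u) (S z) s))
          where
          A B : ℚ
          A = sg (S u) + sg e * sg (S v)
          B = sg (S u) + sg s * sg (S z)
          by-cases : (S u xor S v ≡ e) ⊎ (A ≡ 0ℚ) → (S u xor S z ≡ s) ⊎ (B ≡ 0ℚ) → A * B ≡ 0ℚ
          by-cases (inj₂ h) _        = trans (cong (_* B) h) (ℚ.*-zeroˡ B)
          by-cases (inj₁ _) (inj₂ k) = trans (cong (A *_) k) (ℚ.*-zeroʳ A)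
          by-cases (inj₁ h) (inj₁ k) = ⊥-elim (no-root S root h k)

-- Triangular forms on cut vectors

δ : Form → Bool → Bool → Bool → ℚ
δ f-uv∣w i j k = χ (i xor j) - χ (i xor k) - χ (j xor k)
δ f-wv∣u i j k = χ (k xor j) - χ (k xor i) - χ (j xor i)
δ f-uw∣v i j k = χ (i xor k) - χ (i xor j) - χ (k xor j)
δ f-uvw  i j k = χ (i xor j) + χ (i xor k) + χ (j xor k) - 2ℚ

Δ-Cut : ∀ {N} f {p q r : Fin N} S → p ≢ q → p ≢ r → q ≢ r → Δ f p q r (Cut S) ≡ δ f (S p) (S q) (S r)
Δ-Cut f-uv∣w S pq pr qr = cong₂ _-_ (cong₂ _-_ (coord-Cut S pq) (coord-Cut S pr)) (coord-Cut S qr)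
Δ-Cut f-wv∣u S pq pr qr = cong₂ _-_ (cong₂ _-_ (coord-Cut S (qr ∘ sym)) (coord-Cut S (pr ∘ sym))) (coord-Cut S (pq ∘ sym))
Δ-Cut f-uw∣v S pq pr qr = cong₂ _-_ (cong₂ _-_ (coord-Cut S pr) (coord-Cut S pq)) (coord-Cut S (qr ∘ sym))
Δ-Cut f-uvw  S pq pr qr = cong (_- 2ℚ) (cong₂ _+_ (cong₂ _+_ (coord-Cut S pq) (coord-Cut S pr)) (coord-Cut S qr))

private
  all-bools : ∀ {P : Bool → Bool} → T (P true ∧ P false) → ∀ b → T (P b)
  all-bools {P} h b with P true in pt | P false in pf
  all-bools {P} h true  | true | true = subst T (sym pt) tt
  all-bools {P} h false | true | true = subst T (sym pf) tt

  -- For a concrete `P` the hypothesis evaluates to the unit type, so all eight cases are settled by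
  -- `tt`.
  all-triples : ∀ {P : Bool → Bool → Bool → Bool} →
                T (((P true true true ∧ P true true false) ∧ (P true false true ∧ P true false false)) ∧
                   ((P false true true ∧ P false true false) ∧ (P false false true ∧ P false false false))) →
                ∀ i j k → T (P i j k)
  all-triples {P} h i j = all-bools {λ k → P i j k}
    (all-bools {λ j → P i j true ∧ P i j false}
      (all-bools {λ i → (P i true true ∧ P i true false) ∧ (P i false true ∧ P i false false)} h i) j)

δ-nonpos : ∀ f i j k → δ f i j k ≤ 0ℚ
δ-nonpos f i j k = ℚ.≤ᵇ⇒≤ (all-triples {λ i j k → δ f i j k ≤ᵇ 0ℚ} (holds f) i j k)
  where
  holds : ∀ f → let P = λ i j k → δ f i j k ≤ᵇ 0ℚ in
          T (((P true true true ∧ P true true false) ∧ (P true false true ∧ P true false false)) ∧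
             ((P false true true ∧ P false true false) ∧ (P false false true ∧ P false false false)))
  holds f-uv∣w = tt
  holds f-wv∣u = tt
  holds f-uw∣v = tt
  holds f-uvw  = tt

-- A cut extends to the new node w of uv by making w a copy of one endpoint, the target, twisted (moved to the other
-- side) for the form Δ(u,v,w). This is a zero of the form, and w is free to move when uv is cut exactly as freeState says.

target other : ∀ {A : Set} → Form → A → A → A
target f-uw∣v u v = v
target _      u v = u
other  f-uw∣v u v = u
other  _      u v = v

twist freeState : Form → Bool
twist f-uvw = true
twist _     = false
freeState f-uv∣w = true
freeState f-wv∣u = false
freeState f-uw∣v = false
freeState f-uvw  = true

δ-extension : ∀ f i j → δ f i j (twist f xor target f i j) ≡ 0ℚ
δ-extension f-uv∣w true  true  = refl
δ-extension f-uv∣w true  false = refl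
δ-extension f-uv∣w false true  = refl
δ-extension f-uv∣w false false = refl
δ-extension f-wv∣u true  true  = refl
δ-extension f-wv∣u true  false = refl
δ-extension f-wv∣u false true  = refl
δ-extension f-wv∣u false false = refl
δ-extension f-uw∣v true  true  = refl
δ-extension f-uw∣v true  false = refl
δ-extension f-uw∣v false true  = refl
δ-extension f-uw∣v false false = refl
δ-extension f-uvw  true  true  = refl
δ-extension f-uvw  true  false = refl
δ-extension f-uvw  false true  = refl
δ-extension f-uvw  false false = refl

δ-free : ∀ f i j k → i xor j ≡ freeState f → δ f i j k ≡ 0ℚ
δ-free f-uv∣w true  false true  _ = refl
δ-free f-uv∣w true  false false _ = refl
δ-free f-uv∣w false true  true  _ = refl
δ-free f-uv∣w false true  false _ = refl
δ-free f-wv∣u true  true  true  _ = refl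
δ-free f-wv∣u true  true  false _ = refl
δ-free f-wv∣u false false true  _ = refl
δ-free f-wv∣u false false false _ = refl
δ-free f-uw∣v true  true  true  _ = refl
δ-free f-uw∣v true  true  false _ = refl
δ-free f-uw∣v false false true  _ = refl
δ-free f-uw∣v false false false _ = refl
δ-free f-uvw  true  false true  _ = refl
δ-free f-uvw  true  false false _ = refl
δ-free f-uvw  false true  true  _ = refl
δ-free f-uvw  false true  false _ = refl

-- Extending cuts to the eliminated graph

module TriangularElimination
  {n N' : ℕ} (F : Fin n → Fin n → Bool) (G' : Graph N') (ι : Fin n → Fin N') (w : Fin n → Fin n → Fin N')
  (elim : IsTriElimGraph (K n) F G' ι w)
  (a : PairVec n) (a0 : ℚ) (a' : PairVec N') (a0' : ℚ) (ineq : IsTriElimIneq G' F ι w a a0 a' a0') where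

  ι-injective : ∀ u v → ι u ≡ ι v → u ≡ v
  ι-injective = proj₁ (proj₂ elim)

  w-injective : ∀ u v u₁ v₁ → InF F u v → InF F u₁ v₁ → w u v ≡ w u₁ v₁ → (u ≡ u₁) × (v ≡ v₁)
  w-injective = proj₁ (proj₂ (proj₂ elim))

  ι≢w : ∀ u v z → InF F u v → ι z ≢ w u v
  ι≢w = proj₁ (proj₂ (proj₂ (proj₂ elim)))

  Node : Fin N' → Set
  Node p = (∃ λ z → ι z ≡ p) ⊎ (∃ λ u → ∃ λ v → InF F u v × (w u v ≡ p))

  node : ∀ p → Node p
  node = proj₁ (proj₂ (proj₂ (proj₂ (proj₂ elim))))

  ι-adj : ∀ u v → toℕ u <ℕ toℕ v → adj G' (ι u) (ι v) ≡ not (F u v)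
  ι-adj u v u<v = proj₂ (proj₂ (proj₂ (proj₂ (proj₂ (proj₂ elim))))) u v u<v (K-adj (distinct u<v))

  form : Fin n → Fin n → Form
  form = proj₁ (proj₂ ineq)

  private
    κ-of : ∀ {p} → Node p → Fin n
    κ-of (inj₁ (z , _))         = z
    κ-of (inj₂ (u , v , _ , _)) = target (form u v) u v

    τ-of : ∀ {p} → Node p → Bool
    τ-of (inj₁ _)               = false
    τ-of (inj₂ (u , v , _ , _)) = twist (form u v)

    -- `node` returns some witness of the covering hypothesis. The copied node is computed for an
    -- arbitrary witness; injectivity and disjointness of the labels make the result independent of
    -- it.
    κ-of-ι : ∀ z (o : Node (ι z)) → κ-of o ≡ z
    κ-of-ι z (inj₁ (z′ , eq))         = ι-injective z′ z eq
    κ-of-ι z (inj₂ (u , v , uv , eq)) = ⊥-elim (ι≢w u v z uv (sym eq))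

    τ-of-ι : ∀ z (o : Node (ι z)) → τ-of o ≡ false
    τ-of-ι z (inj₁ (z′ , eq))         = refl
    τ-of-ι z (inj₂ (u , v , uv , eq)) = ⊥-elim (ι≢w u v z uv (sym eq))

    κ-of-w : ∀ {u v} → InF F u v → (o : Node (w u v)) → κ-of o ≡ target (form u v) u v
    κ-of-w {u} {v} uv (inj₁ (z , eq)) = ⊥-elim (ι≢w u v z uv eq)
    κ-of-w {u} {v} uv (inj₂ (u′ , v′ , u′v′ , eq)) with w-injective u′ v′ u v u′v′ uv eq
    ... | refl , refl = refl

    τ-of-w : ∀ {u v} → InF F u v → (o : Node (w u v)) → τ-of o ≡ twist (form u v)
    τ-of-w {u} {v} uv (inj₁ (z , eq)) = ⊥-elim (ι≢w u v z uv eq)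
    τ-of-w {u} {v} uv (inj₂ (u′ , v′ , u′v′ , eq)) with w-injective u′ v′ u v u′v′ uv eq
    ... | refl , refl = refl

  κ : Fin N' → Fin n
  κ p = κ-of (node p)

  τ : Fin N' → Bool
  τ p = τ-of (node p)

  κ-ι : ∀ z → κ (ι z) ≡ z
  κ-ι z = κ-of-ι z (node (ι z))

  τ-ι : ∀ z → τ (ι z) ≡ false
  τ-ι z = τ-of-ι z (node (ι z))

  κ-w : ∀ {u v} → InF F u v → κ (w u v) ≡ target (form u v) u v
  κ-w {u} {v} uv = κ-of-w uv (node (w u v))

  τ-w : ∀ {u v} → InF F u v → τ (w u v) ≡ twist (form u v)
  τ-w {u} {v} uv = τ-of-w uv (node (w u v))

  ext : Subset n → Subset N'
  ext S p = τ p xor S (κ p)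

  ext-ι : ∀ S z → ext S (ι z) ≡ S z
  ext-ι S z = cong₂ (λ t k → t xor S k) (τ-ι z) (κ-ι z)

  target-map : ∀ {A B : Set} (h : A → B) f u v → h (target f u v) ≡ target f (h u) (h v)
  target-map h f-uv∣w u v = refl
  target-map h f-wv∣u u v = refl
  target-map h f-uw∣v u v = refl
  target-map h f-uvw  u v = refl

  ext-w : ∀ S {u v} → InF F u v → ext S (w u v) ≡ twist (form u v) xor target (form u v) (S u) (S v)
  ext-w S {u} {v} uv = trans (cong₂ (λ t k → t xor S k) (τ-w uv) (κ-w uv)) (cong (twist (form u v) xor_) (target-map S (form u v) u v))

  δ-at : Subset N' → Fin n → Fin n → ℚ
  δ-at S u v = δ (form u v) (S (ι u)) (S (ι v)) (S (w u v))

  Tight : Subset N' → Set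
  Tight S = ∀ u v → InF F u v → δ-at S u v ≡ 0ℚ

  Free : Subset N' → Fin n → Fin n → Set
  Free S u v = S (ι u) xor S (ι v) ≡ freeState (form u v)

  ext-tight : ∀ S → Tight (ext S)
  ext-tight S u v uv = begin
    δ (form u v) (ext S (ι u)) (ext S (ι v)) (ext S (w u v))
      ≡⟨ cong₂ (λ i j → δ (form u v) i j (ext S (w u v))) (ext-ι S u) (ext-ι S v) ⟩
    δ (form u v) (S u) (S v) (ext S (w u v))
      ≡⟨ cong (δ (form u v) (S u) (S v)) (ext-w S uv) ⟩
    δ (form u v) (S u) (S v) (twist (form u v) xor target (form u v) (S u) (S v))
      ≡⟨ δ-extension (form u v) (S u) (S v) ⟩
    0ℚ ∎

  flip-w-ι : ∀ {u v} S z → InF F u v → flip (w u v) S (ι z) ≡ S (ι z)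
  flip-w-ι {u} {v} S z uv = flip-other S (ι≢w u v z uv ∘ sym)

  flip-free : ∀ {u v} S r s → InF F u v → Free S r s → Free (flip (w u v) S) r s
  flip-free S r s uv free = trans (cong₂ _xor_ (flip-w-ι S r uv) (flip-w-ι S s uv)) free

  -- By injectivity of `w`, only the form of uv contains the moved node, and this form does not see
  -- its position while uv is free.
  flip-tight : ∀ {u v} S → InF F u v → Free S u v → Tight S → Tight (flip (w u v) S)
  flip-tight {u} {v} S uv free tight r s rs = by-cases (w u v ≟ w r s)
    where
    S′ = flip (w u v) S
    by-cases : Dec (w u v ≡ w r s) → δ-at S′ r s ≡ 0ℚ
    by-cases (yes eq) = δ-free (form r s) (S′ (ι r)) (S′ (ι s)) (S′ (w r s))
      (flip-free S r s uv (subst₂ (Free S) (proj₁ same) (proj₂ same) free))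
      where
      same = w-injective u v r s uv rs eq
    by-cases (no ne) = trans (cong₂ (λ i j → δ (form r s) i j (S′ (w r s))) (flip-w-ι S r uv) (flip-w-ι S s uv))
      (trans (cong (δ (form r s) (S (ι r)) (S (ι s))) (flip-other S ne)) (tight r s rs))

  private
    onlyIf : Bool → ℚ → ℚ
    onlyIf b x = if b then x else 0ℚ

  -- The identity that defines the eliminated inequality lives on all pairs of nodes, while the cut
  -- vector of `G'` is zero off its edges. As `a'` is zero there too, the cut vector of the complete
  -- graph may take its place.
  a'-Cut : ∀ S → a' · cutVec G' S ≡ a' · Cut S
  a'-Cut S = ∑pairs-cong λ p q p<q → trans (move (adj G' p q) (S p xor S q) (proj₁ ineq p q p<q))
    (cong (λ e → a' p q * (if e ∧ (S p xor S q) then 1ℚ else 0ℚ)) (sym (K-adj (distinct p<q))))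
    where
    move : ∀ e s {x} → (e ≡ false → x ≡ 0ℚ) → x * (if e ∧ s then 1ℚ else 0ℚ) ≡ x * (if s then 1ℚ else 0ℚ)
    move true  s h = refl
    move false s h = trans (cong (_* 0ℚ) (h refl)) (trans (sym (ℚ.*-zeroˡ (χ s))) (cong (_* χ s) (sym (h refl))))

  pull-Cut : ∀ S → a · pull ι (Cut S) ≡ a · Cut (S ∘ ι)
  pull-Cut S = ·-congʳ a λ u v u<v →
    trans (coord-Cut S (distinct u<v ∘ ι-injective u v))
          (cong (λ e → if e ∧ (S (ι u) xor S (ι v)) then 1ℚ else 0ℚ) (sym (K-adj (distinct u<v))))

  excess : ∀ S → a' · cutVec G' S - a0' ≡
                 (a · Cut (S ∘ ι) - a0) + ∑pairs (λ u v → onlyIf (F u v) (∣ a u v ∣ * δ-at S u v))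
  excess S = begin
    a' · cutVec G' S - a0'
      ≡⟨ cong (_- a0') (a'-Cut S) ⟩
    a' · Cut S - a0'
      ≡⟨ proj₂ (proj₂ ineq) (Cut S) ⟩
    (a · pull ι (Cut S) - a0) + ∑pairs (λ u v → onlyIf (F u v) (∣ a u v ∣ * Δ (form u v) (ι u) (ι v) (w u v) (Cut S)))
      ≡⟨ cong₂ _+_ (cong (_- a0) (pull-Cut S)) (∑pairs-cong λ u v u<v → on-F u v u<v (F u v) refl) ⟩
    (a · Cut (S ∘ ι) - a0) + ∑pairs (λ u v → onlyIf (F u v) (∣ a u v ∣ * δ-at S u v)) ∎
    where
    on-F : ∀ u v → toℕ u <ℕ toℕ v → ∀ b → F u v ≡ b →
           onlyIf b (∣ a u v ∣ * Δ (form u v) (ι u) (ι v) (w u v) (Cut S)) ≡ onlyIf b (∣ a u v ∣ * δ-at S u v)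
    on-F u v u<v false _  = refl
    on-F u v u<v true  Fuv = cong (∣ a u v ∣ *_)
      (Δ-Cut (form u v) S (distinct u<v ∘ ι-injective u v) (ι≢w u v u (u<v , Fuv)) (ι≢w u v v (u<v , Fuv)))

  tight-excess : ∀ S → Tight S → a' · cutVec G' S - a0' ≡ a · Cut (S ∘ ι) - a0
  tight-excess S tight = trans (excess S)
    (trans (cong ((a · Cut (S ∘ ι) - a0) +_) (∑pairs-zero λ u v u<v → on-F u v u<v (F u v) refl)) (ℚ.+-identityʳ (a · Cut (S ∘ ι) - a0)))
    where
    on-F : ∀ u v → toℕ u <ℕ toℕ v → ∀ b → F u v ≡ b → onlyIf b (∣ a u v ∣ * δ-at S u v) ≡ 0ℚ
    on-F u v u<v false _   = refl
    on-F u v u<v true  Fuv = trans (cong (∣ a u v ∣ *_) (tight u v (u<v , Fuv))) (ℚ.*-zeroʳ ∣ a u v ∣)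

  ext-excess : ∀ S → a' · cutVec G' (ext S) - a0' ≡ a · Cut S - a0
  ext-excess S = trans (tight-excess (ext S) (ext-tight S))
    (cong (_- a0) (·-congʳ a λ u v _ → cutVec-cong (K n) (ext-ι S) u v))

  -- Every triangular form is at most zero on cuts and enters with the weight |a_uv|, so the
  -- correction to the original inequality is never positive.
  valid : Valid (K n) a a0 → Valid G' a' a0'
  valid a-valid S = subst₂ _≤_ (recover (a' · cutVec G' S) a0') (ℚ.+-identityˡ a0')
    (ℚ.+-monoˡ-≤ a0' (subst (_≤ 0ℚ) (sym (excess S)) (ℚ.+-mono-≤ base-nonpos correction-nonpos)))
    where
    recover : ∀ x y → x - y + y ≡ x
    recover = solve 2 (λ x y → x :- y :+ y := x) refl
    base-nonpos : a · Cut (S ∘ ι) - a0 ≤ 0ℚ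
    base-nonpos = subst (a · Cut (S ∘ ι) - a0 ≤_) (ℚ.+-inverseʳ a0) (ℚ.+-monoˡ-≤ (- a0) (a-valid (S ∘ ι)))
    correction-nonpos : ∑pairs (λ u v → onlyIf (F u v) (∣ a u v ∣ * δ-at S u v)) ≤ 0ℚ
    correction-nonpos = ∑pairs-nonpos _ λ u v → on (F u v) (scale ∣ a u v ∣ (δ-at S u v) (ℚ.0≤∣p∣ (a u v)) (δ-nonpos (form u v) (S (ι u)) (S (ι v)) (S (w u v))))
      where
      scale : ∀ x y → 0ℚ ≤ x → y ≤ 0ℚ → x * y ≤ 0ℚ
      scale x y 0≤x y≤0 = subst (x * y ≤_) (ℚ.*-zeroʳ x) (ℚ.*-monoˡ-≤-nonNeg x {{nonNegative 0≤x}} y≤0)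
      on : ∀ b {x} → x ≤ 0ℚ → onlyIf b x ≤ 0ℚ
      on true  h = h
      on false h = ℚ.≤-refl

-- Equations that hold on all roots of the eliminated inequality

private
  1*1+0 : ∀ x → 1ℚ * x + 0ℚ ≡ x
  1*1+0 = solve 1 (λ x → con 1ℚ :* x :+ con 0ℚ := x) refl

  zero-in-product : ∀ x y z → x ≡ 0ℚ → x * y * z ≡ 0ℚ
  zero-in-product x y z x≡0 = trans (cong (λ x → x * y * z) x≡0) (solve 2 (λ y z → con 0ℚ :* y :* z := con 0ℚ) refl y z)

third-node : ∀ {k} (u v : Fin (suc (suc (suc k)))) → ∃ λ z → u ≢ z × v ≢ z
third-node zero          zero          = suc zero , (λ ()) , (λ ())
third-node zero          (suc zero)    = suc (suc zero) , (λ ()) , (λ ())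
third-node zero          (suc (suc _)) = suc zero , (λ ()) , (λ ())
third-node (suc zero)    zero          = suc (suc zero) , (λ ()) , (λ ())
third-node (suc zero)    (suc _)       = zero , (λ ()) , (λ ())
third-node (suc (suc _)) zero          = suc zero , (λ ()) , (λ ())
third-node (suc (suc _)) (suc _)       = zero , (λ ()) , (λ ())

-- The coordinate x_ij of the indicator vector of rs, extended by zero to the diagonal.
module _ {n : ℕ} where

  indicator : Fin n → Fin n → Fin n → Fin n → ℚ
  indicator r s i j = ½ * (signs i j (λ _ _ → 0ℚ) - signs i j e[ r , s ])

  indicator-≢ : ∀ {r s i j} → i ≢ j → indicator r s i j ≡ coord e[ r , s ] i j
  indicator-≢ {r} {s} {i} {j} i≢j = begin
    ½ * (signs i j (λ _ _ → 0ℚ) - signs i j e[ r , s ])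
      ≡⟨ cong₂ (λ p q → ½ * (p - q)) (signs-≢ i≢j (λ _ _ → 0ℚ)) (signs-≢ i≢j e[ r , s ]) ⟩
    ½ * ((1ℚ - 2ℚ * coord (λ _ _ → 0ℚ) i j) - (1ℚ - 2ℚ * coord e[ r , s ] i j))
      ≡⟨ cong (λ o → ½ * ((1ℚ - 2ℚ * o) - (1ℚ - 2ℚ * coord e[ r , s ] i j))) (coord-0 (toℕ i <ᵇ toℕ j)) ⟩
    ½ * ((1ℚ - 2ℚ * 0ℚ) - (1ℚ - 2ℚ * coord e[ r , s ] i j))
      ≡⟨ simplify (coord e[ r , s ] i j) ⟩
    coord e[ r , s ] i j ∎
    where
    coord-0 : ∀ b → (if b then 0ℚ else 0ℚ) ≡ 0ℚ
    coord-0 true  = refl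
    coord-0 false = refl
    simplify : ∀ x → ½ * ((1ℚ - 2ℚ * 0ℚ) - (1ℚ - 2ℚ * x)) ≡ x
    simplify = solve 1 (λ x → con ½ :* ((con 1ℚ :- con 2ℚ :* con 0ℚ) :- (con 1ℚ :- con 2ℚ :* x)) := x) refl

  signs-sym : ∀ (i j : Fin n) x → signs i j x ≡ signs j i x
  signs-sym i j x = by-cases (i ≟ j)
    where
    by-cases : Dec (i ≡ j) → signs i j x ≡ signs j i x
    by-cases (yes refl) = refl
    by-cases (no i≢j)   = trans (signs-≢ i≢j x) (trans (cong (λ c → 1ℚ - 2ℚ * c) (coord-sym x i j)) (sym (signs-≢ (i≢j ∘ sym) x)))

  indicator-sym : ∀ r s i j → indicator r s i j ≡ indicator r s j i
  indicator-sym r s i j = cong₂ (λ p q → ½ * (p - q)) (signs-sym i j (λ _ _ → 0ℚ)) (signs-sym i j e[ r , s ])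

  indicator-diag : ∀ r s i → indicator r s i i ≡ 0ℚ
  indicator-diag r s i = trans
    (cong (λ b → ½ * ((if b then 1ℚ else (1ℚ - 2ℚ * coord (λ _ _ → 0ℚ) i i)) - (if b then 1ℚ else (1ℚ - 2ℚ * coord e[ r , s ] i i)))) (⌊≟⌋-refl i))
    refl

  indicator-off : ∀ {r s i j} → ¬ (i ≡ r × j ≡ s) → ¬ (i ≡ s × j ≡ r) → indicator r s i j ≡ 0ℚ
  indicator-off {r} {s} {i} {j} ne ne′ = by-cases (i ≟ j)
    where
    by-cases : Dec (i ≡ j) → indicator r s i j ≡ 0ℚ
    by-cases (yes refl) = indicator-diag r s i
    by-cases (no i≢j)   = trans (indicator-≢ i≢j) (guarded (toℕ i <ᵇ toℕ j))
      where
      guarded : ∀ b → (if b then e[ r , s ] i j else e[ r , s ] j i) ≡ 0ℚ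
      guarded true  = e-other λ { refl → ne (refl , refl) }
      guarded false = e-other λ { refl → ne′ (refl , refl) }

  indicator-on : ∀ {r s} → toℕ r <ℕ toℕ s → indicator r s r s ≡ 1ℚ
  indicator-on {r} {s} r<s = trans (indicator-≢ (distinct r<s)) (trans (coord-< e[ r , s ] r<s) (e-self r s))

-- The order of a new node and a labelled node within `Fin N'` is unknown, so the surviving pair may
-- occur in either orientation.
∑pairs-single-sym : ∀ {N} (f : Fin N → Fin N → ℚ) → (∀ p q → f p q ≡ f q p) → ∀ {p q} → p ≢ q →
                    (∀ i j → ¬ (i ≡ p × j ≡ q) → ¬ (i ≡ q × j ≡ p) → f i j ≡ 0ℚ) → ∑pairs f ≡ f p q
∑pairs-single-sym {N} f f-sym {p} {q} p≢q = ≢-ordered P P-sym ordered-case p≢q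
  where
  P : Fin N → Fin N → Set
  P p q = (∀ i j → ¬ (i ≡ p × j ≡ q) → ¬ (i ≡ q × j ≡ p) → f i j ≡ 0ℚ) → ∑pairs f ≡ f p q
  P-sym : ∀ {p q} → P p q → P q p
  P-sym {p} {q} h off = trans (h λ i j ne ne′ → off i j ne′ ne) (f-sym p q)
  ordered-case : ∀ p q → toℕ p <ℕ toℕ q → P p q
  ordered-case p q p<q off = ∑pairs-single f p<q λ i j i<j ne → off i j ne
    λ { (refl , refl) → ℕ.<-asym p<q i<j }

module Vanishing
  {k N' : ℕ} (F : Fin (suc (suc (suc k))) → Fin (suc (suc (suc k))) → Bool) (G' : Graph N')
  (ι : Fin (suc (suc (suc k))) → Fin N') (w : Fin (suc (suc (suc k))) → Fin (suc (suc (suc k))) → Fin N')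
  (elim : IsTriElimGraph (K (suc (suc (suc k)))) F G' ι w)
  (a : PairVec (suc (suc (suc k)))) (a0 : ℚ) (a' : PairVec N') (a0' : ℚ) (ineq : IsTriElimIneq G' F ι w a a0 a' a0')
  (facet : FacetInducing (K (suc (suc (suc k)))) a a0) (nontriangle : ¬ IsTriangle a a0) where

  private
    n : ℕ
    n = suc (suc (suc k))

  open TriangularElimination F G' ι w elim a a0 a' a0' ineq
  open NonTriangle a a0 facet nontriangle
  open Facet a a0 facet

  -- The pq-coordinate of an extended cut as an affine function on K_n: ½ (1 - σ_p σ_q), where each
  -- node has the sign of the node it copies, up to its twist.
  Λ : Fin N' → Fin N' → PairVec n → ℚ
  Λ p q x = if adj G' p q then ½ * (1ℚ - sg (τ p) * sg (τ q) * signs (κ p) (κ q) x) else 0ℚ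

  affine-Λ : ∀ p q → Affine (Λ p q)
  affine-Λ p q = by-cases (adj G' p q)
    where
    by-cases : ∀ e → Affine (λ x → if e then ½ * (1ℚ - sg (τ p) * sg (τ q) * signs (κ p) (κ q) x) else 0ℚ)
    by-cases false = affine-const 0ℚ
    by-cases true  = affine-* ½ (affine-≗ (λ x → solve 2 (λ t y → con 1ℚ :- t :* y := con 1ℚ :+ (:- t) :* y) refl (sg (τ p) * sg (τ q)) (signs (κ p) (κ q) x))
                       (affine-+ (affine-const 1ℚ) (affine-* (- (sg (τ p) * sg (τ q))) (affine-signs (κ p) (κ q)))))

  Λ-Cut : ∀ p q S → Λ p q (Cut S) ≡ cutVec G' (ext S) p q
  Λ-Cut p q S = trans (cong (λ z → if adj G' p q then ½ * (1ℚ - sg (τ p) * sg (τ q) * z) else 0ℚ) (signs-Cut (κ p) (κ q) S))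
                      (by-cases (adj G' p q) (τ p) (τ q) (S (κ p)) (S (κ q)))
    where
    by-signs : ∀ t t′ s s′ → ½ * (1ℚ - sg t * sg t′ * (sg s * sg s′)) ≡ χ ((t xor s) xor (t′ xor s′))
    by-signs t t′ s s′ = begin
      ½ * (1ℚ - sg t * sg t′ * (sg s * sg s′))          ≡⟨ cong (λ p → ½ * (1ℚ - p)) (exchange (sg t) (sg t′) (sg s) (sg s′)) ⟩
      ½ * (1ℚ - (sg t * sg s) * (sg t′ * sg s′))        ≡⟨ cong₂ (λ p q → ½ * (1ℚ - p * q)) (sg-xor t s) (sg-xor t′ s′) ⟨
      ½ * (1ℚ - sg (t xor s) * sg (t′ xor s′))          ≡⟨ cong (λ p → ½ * (1ℚ - p)) (sg-χ (t xor s) (t′ xor s′)) ⟨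
      ½ * (1ℚ - (1ℚ - 2ℚ * χ ((t xor s) xor (t′ xor s′)))) ≡⟨ simplify (χ ((t xor s) xor (t′ xor s′))) ⟩
      χ ((t xor s) xor (t′ xor s′))                     ∎
      where
      exchange : ∀ a b c d → a * b * (c * d) ≡ (a * c) * (b * d)
      exchange = solve 4 (λ a b c d → a :* b :* (c :* d) := (a :* c) :* (b :* d)) refl
      simplify : ∀ x → ½ * (1ℚ - (1ℚ - 2ℚ * x)) ≡ x
      simplify = solve 1 (λ x → con ½ :* (con 1ℚ :- (con 1ℚ :- con 2ℚ :* x)) := x) refl
    by-cases : ∀ e t t′ s s′ → (if e then ½ * (1ℚ - sg t * sg t′ * (sg s * sg s′)) else 0ℚ) ≡
                               (if e ∧ ((t xor s) xor (t′ xor s′)) then 1ℚ else 0ℚ)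
    by-cases true  t t′ s s′ = by-signs t t′ s s′
    by-cases false t t′ s s′ = refl

  module _ (b : PairVec N') (b0 : ℚ) where

    -- The equation b · x = b₀ along extensions, written as an affine function of the original cut
    -- vector so that `multiple-of-slack` and `affine-vanish` apply.
    pulled : PairVec n → ℚ
    pulled x = ∑pairs (λ p q → b p q * Λ p q x) + (- b0)

    affine-pulled : Affine pulled
    affine-pulled = affine-+ (affine-∑pairs {Q = λ p q x → b p q * Λ p q x} λ p q → affine-* (b p q) (affine-Λ p q)) (affine-const (- b0))

    pulled-Cut : ∀ S → pulled (Cut S) ≡ b · cutVec G' (ext S) - b0
    pulled-Cut S = cong (_- b0) (∑pairs-cong λ p q _ → cong (b p q *_) (Λ-Cut p q S))

  -- The situation after the multiple of the eliminated inequality is subtracted: the equation holds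
  -- on the extension of every cut, root or not, and still on all tight cuts that restrict to roots.
  module Rows (b : PairVec N') (b0 : ℚ)
              (on-exts : ∀ S → b · cutVec G' (ext S) ≡ b0)
              (on-roots : ∀ S → Tight S → a · Cut (S ∘ ι) ≡ a0 → b · cutVec G' S ≡ b0) where

    W : Fin N' → Fin N' → ℚ
    W = weight G' b

    W-sym : ∀ p q → W p q ≡ W q p
    W-sym = weight-sym G' b

    row : ∀ {u v} → InF F u v → ∀ S → Tight S → a · Cut (S ∘ ι) ≡ a0 → Free S u v → ∑ (λ q → W (w u v) q * sg (S q)) ≡ 0ℚ
    row {u} {v} uv S tight root free = flip-vanish G' b b0 (w u v) S (on-roots S tight root)
      (on-roots (flip (w u v) S) (flip-tight S uv free tight)
        (trans (·-congʳ a λ r s _ → cutVec-cong (K n) (λ z → flip-w-ι S z uv) r s) root))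

    ext-root : ∀ S → a · Cut S ≡ a0 → a · Cut (ext S ∘ ι) ≡ a0
    ext-root S root = trans (·-congʳ a λ r s _ → cutVec-cong (K n) (ext-ι S) r s) root

    ext-free : ∀ S u v → S u xor S v ≡ freeState (form u v) → Free (ext S) u v
    ext-free S u v h = trans (cong₂ _xor_ (ext-ι S u) (ext-ι S v)) h

    row-ext : ∀ {u v} → InF F u v → ∀ S → a · Cut S ≡ a0 → S u xor S v ≡ freeState (form u v) →
              ∑ (λ q → W (w u v) q * sg (ext S q)) ≡ 0ℚ
    row-ext {u} {v} uv S root free = row uv (ext S) (ext-tight S) (ext-root S root) (ext-free S u v free)

    -- Flipping two new nodes that are simultaneously free.
    W-both-free : ∀ {u v r s} → InF F u v → InF F r s → ∀ S → a · Cut S ≡ a0 →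
                  S u xor S v ≡ freeState (form u v) → S r xor S s ≡ freeState (form r s) → W (w u v) (w r s) ≡ 0ℚ
    W-both-free {u} {v} {r} {s} uv rs S root free free′ = trans (sym (∑-unit (W (w u v)) (w r s)))
      (linear-vanish (W (w u v)) id (w r s) (ext S) (row-ext uv S root free)
        (row uv (flip (w r s) (ext S)) (flip-tight (ext S) rs (ext-free S r s free′) (ext-tight S))
          (trans (·-congʳ a λ i j _ → cutVec-cong (K n) (λ z → flip-w-ι (ext S) z rs) i j) (ext-root S root))
          (flip-free (ext S) u v rs (ext-free S u v free))))

    -- If the entry were nonzero, no root would leave both new nodes free. Then σ_r + ε σ_s, with ε
    -- the sign of `freeState` for rs, would vanish on all roots where uv is free. Unless the two
    -- edges coincide, r or s lies outside {u, v}, and its nonzero coefficient contradicts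
    -- `coefficient-vanishes`.
    W-w-w : ∀ {u v r s} → InF F u v → InF F r s → W (w u v) (w r s) ≡ 0ℚ
    W-w-w {u} {v} {r} {s} uv rs = ≡0-stable (W (w u v) (w r s)) λ W≢0 → by-cases W≢0 (u ≟ r) (v ≟ r) (u ≟ s) (v ≟ s)
      where
      pick : Fin 2 → Fin n
      pick zero       = r
      pick (suc zero) = s
      coeff : Fin 2 → ℚ
      coeff zero       = 1ℚ
      coeff (suc zero) = sg (freeState (form r s))
      never-free : W (w u v) (w r s) ≢ 0ℚ → ∀ S → a · Cut S ≡ a0 → S u xor S v ≡ freeState (form u v) →
                   ∑ (λ i → coeff i * sg (S (pick i))) ≡ 0ℚ
      never-free W≢0 S root free = from (agree-or-zero (S r) (S s) (freeState (form r s)))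
        where
        E = sg (freeState (form r s))
        from : (S r xor S s ≡ freeState (form r s)) ⊎ (sg (S r) + E * sg (S s) ≡ 0ℚ) → 1ℚ * sg (S r) + (E * sg (S s) + 0ℚ) ≡ 0ℚ
        from (inj₁ free′) = ⊥-elim (W≢0 (W-both-free uv rs S root free free′))
        from (inj₂ h)     = trans (cong₂ _+_ (ℚ.*-identityˡ (sg (S r))) (ℚ.+-identityʳ (E * sg (S s)))) h
      r≢s : r ≢ s
      r≢s = distinct (proj₁ rs)
      at-r : u ≢ r → v ≢ r → ¬ (W (w u v) (w r s) ≢ 0ℚ)
      at-r u≢r v≢r W≢0 = ℚ.1≢0 (trans (sym (value (sg (freeState (form r s)))))
        (trans (cong₂ (λ p q → 1ℚ * p + (sg (freeState (form r s)) * q + 0ℚ)) (sym (unit-self r)) (sym (unit-other r≢s)))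
               (coefficient-vanishes (distinct (proj₁ uv)) u≢r v≢r (freeState (form u v)) coeff pick (never-free W≢0))))
        where
        value : ∀ e → 1ℚ * 1ℚ + (e * 0ℚ + 0ℚ) ≡ 1ℚ
        value = solve 1 (λ e → con 1ℚ :* con 1ℚ :+ (e :* con 0ℚ :+ con 0ℚ) := con 1ℚ) refl
      at-s : u ≢ s → v ≢ s → ¬ (W (w u v) (w r s) ≢ 0ℚ)
      at-s u≢s v≢s W≢0 = sg≢0 (freeState (form r s)) (trans (sym (value (sg (freeState (form r s)))))
        (trans (cong₂ (λ p q → 1ℚ * p + (sg (freeState (form r s)) * q + 0ℚ)) (sym (unit-other (r≢s ∘ sym))) (sym (unit-self s)))
               (coefficient-vanishes (distinct (proj₁ uv)) u≢s v≢s (freeState (form u v)) coeff pick (never-free W≢0))))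
        where
        value : ∀ e → 1ℚ * 0ℚ + (e * 1ℚ + 0ℚ) ≡ e
        value = solve 1 (λ e → con 1ℚ :* con 0ℚ :+ (e :* con 1ℚ :+ con 0ℚ) := e) refl
        sg≢0 : ∀ b → sg b ≢ 0ℚ
        sg≢0 true  ()
        sg≢0 false ()
      by-cases : W (w u v) (w r s) ≢ 0ℚ → Dec (u ≡ r) → Dec (v ≡ r) → Dec (u ≡ s) → Dec (v ≡ s) → ⊥
      by-cases W≢0 (no u≢r)   (no v≢r)   _          _          = at-r u≢r v≢r W≢0
      by-cases W≢0 _          _          (no u≢s)   (no v≢s)   = at-s u≢s v≢s W≢0
      by-cases W≢0 (yes refl) _          (yes refl) _          = r≢s refl
      -- Here rs is uv itself and the entry lies on the diagonal. The other coincidences contradict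
      -- `r≢s` or the order of the endpoints.
      by-cases W≢0 (yes refl) _          (no _)     (yes refl) = W≢0 (weight-diag G' b (w u v))
      by-cases W≢0 (no _)     (yes refl) _          (yes refl) = r≢s refl
      by-cases W≢0 (no _)     (yes refl) (yes refl) (no _)     = ℕ.<-asym (proj₁ uv) (proj₁ rs)

    -- All copies of z contribute to the coefficient of its sign. Those that are new nodes drop out
    -- by `W-w-w`, which leaves `ι z` with its trivial twist.
    W-w-ι : ∀ {u v} → InF F u v → ∀ {z} → u ≢ z → v ≢ z → W (w u v) (ι z) ≡ 0ℚ
    W-w-ι {u} {v} uv {z} u≢z v≢z = begin
      W (w u v) (ι z)
        ≡⟨ unscale (W (w u v) (ι z)) ⟩
      W (w u v) (ι z) * 1ℚ * 1ℚ
        ≡⟨ cong₂ (λ t i → W (w u v) (ι z) * t * i) (cong sg (τ-ι z)) (trans (cong (unit z) (κ-ι z)) (unit-self z)) ⟨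
      W (w u v) (ι z) * sg (τ (ι z)) * unit z (κ (ι z))
        ≡⟨ ∑-single (ι z) (λ q → W (w u v) q * sg (τ q) * unit z (κ q)) (λ q q≢ → off q q≢ (node q)) ⟨
      ∑ (λ q → W (w u v) q * sg (τ q) * unit z (κ q))
        ≡⟨ coefficient-vanishes (distinct (proj₁ uv)) u≢z v≢z (freeState (form u v)) (λ q → W (w u v) q * sg (τ q)) κ
             (λ S root free → trans (∑-cong λ q → trans (ℚ.*-assoc (W (w u v) q) (sg (τ q)) (sg (S (κ q))))
                                                        (cong (W (w u v) q *_) (sym (sg-xor (τ q) (S (κ q))))))
                                    (row-ext uv S root free)) ⟩
      0ℚ ∎
      where
      unscale : ∀ x → x ≡ x * 1ℚ * 1ℚ
      unscale = solve 1 (λ x → x := x :* con 1ℚ :* con 1ℚ) refl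
      off : ∀ q → q ≢ ι z → Node q → W (w u v) q * sg (τ q) * unit z (κ q) ≡ 0ℚ
      off q q≢ (inj₂ (r , s , rs , refl)) = zero-in-product (W (w u v) (w r s)) (sg (τ (w r s))) (unit z (κ (w r s))) (W-w-w uv rs)
      off q q≢ (inj₁ (z′ , refl)) =
        trans (cong (W (w u v) (ι z′) * sg (τ (ι z′)) *_) (trans (cong (unit z) (κ-ι z′)) (unit-other (λ z≡z′ → q≢ (cong ι (sym z≡z′))))))
              (ℚ.*-zeroʳ (W (w u v) (ι z′) * sg (τ (ι z′))))

    pulled-zero : ∀ x → pulled b b0 x ≡ 0ℚ
    pulled-zero = affine-vanish (affine-pulled b b0) λ S →
      trans (pulled-Cut b b0 S) (trans (cong (_- b0) (on-exts S)) (ℚ.+-inverseʳ b0))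

    module _ {u v : Fin n} (uv : InF F u v) where

      private
        -- The factor with which the entry at p, q contributes to the coefficient of x_uv in
        -- `pulled`.
        D : Fin N' → Fin N' → ℚ
        D p q = sg (τ p) * sg (τ q) * indicator u v (κ p) (κ q)

        term : Fin N' → Fin N' → ℚ
        term p q = W p q * D p q

        term-sym : ∀ p q → term p q ≡ term q p
        term-sym p q = cong₂ _*_ (W-sym p q) (cong₂ _*_ (ℚ.*-comm (sg (τ p)) (sg (τ q))) (indicator-sym u v (κ p) (κ q)))

        term-W : ∀ p q → W p q ≡ 0ℚ → term p q ≡ 0ℚ
        term-W p q h = trans (cong (_* D p q) h) (ℚ.*-zeroˡ (D p q))

        term-D : ∀ p q → indicator u v (κ p) (κ q) ≡ 0ℚ → term p q ≡ 0ℚ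
        term-D p q h = trans (cong (λ i → W p q * (sg (τ p) * sg (τ q) * i)) h)
                             (trans (cong (W p q *_) (ℚ.*-zeroʳ (sg (τ p) * sg (τ q)))) (ℚ.*-zeroʳ (W p q)))

        increment : ∀ p q → toℕ p <ℕ toℕ q → b p q * Λ p q e[ u , v ] ≡ b p q * Λ p q (λ _ _ → 0ℚ) + term p q
        increment p q p<q = by-cases (adj G' p q) (b p q) (coord b p q) (sym (coord-< b p<q)) (sg (τ p) * sg (τ q))
                                     (signs (κ p) (κ q) e[ u , v ]) (signs (κ p) (κ q) (λ _ _ → 0ℚ))
          where
          by-cases : ∀ e x x′ → x ≡ x′ → ∀ t y₁ y₀ →
                     x * (if e then ½ * (1ℚ - t * y₁) else 0ℚ) ≡
                     x * (if e then ½ * (1ℚ - t * y₀) else 0ℚ) + (if e then x′ else 0ℚ) * (t * (½ * (y₀ - y₁)))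
          by-cases true  x x refl t y₁ y₀ = solve 4 (λ x t y₁ y₀ → x :* (con ½ :* (con 1ℚ :- t :* y₁)) :=
            x :* (con ½ :* (con 1ℚ :- t :* y₀)) :+ x :* (t :* (con ½ :* (y₀ :- y₁)))) refl x t y₁ y₀
          by-cases false x x refl t y₁ y₀ = solve 2 (λ x z → x :* con 0ℚ := x :* con 0ℚ :+ con 0ℚ :* z) refl x (t * (½ * (y₀ - y₁)))

        -- `pulled` vanishes at the zero vector and at the unit vector of uv; the difference of the
        -- two values is the coefficient of x_uv.
        ∑term : ∑pairs term ≡ 0ℚ
        ∑term = compare (∑pairs (λ p q → b p q * Λ p q e[ u , v ])) (∑pairs (λ p q → b p q * Λ p q (λ _ _ → 0ℚ))) b0 (∑pairs term)
          (trans (∑pairs-cong increment) (∑pairs-+ (λ p q → b p q * Λ p q (λ _ _ → 0ℚ)) term))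
          (pulled-zero e[ u , v ]) (pulled-zero (λ _ _ → 0ℚ))
          where
          compare : ∀ x y c t → x ≡ y + t → x + (- c) ≡ 0ℚ → y + (- c) ≡ 0ℚ → t ≡ 0ℚ
          compare x y c t x≡y+t hx hy = begin
            t                          ≡⟨ solve 3 (λ y t c → t := (y :+ t :+ (:- c)) :- (y :+ (:- c))) refl y t c ⟩
            (y + t + - c) - (y + - c)  ≡⟨ cong₂ _-_ (trans (cong (_+ - c) (sym x≡y+t)) hx) hy ⟩
            0ℚ                         ∎

        target-other : ∀ f {i j r s : Fin n} → target f i j ≡ r → other f i j ≡ s → (i ≡ r × j ≡ s) ⊎ (i ≡ s × j ≡ r)
        target-other f-uv∣w p q = inj₁ (p , q)
        target-other f-wv∣u p q = inj₁ (p , q)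
        target-other f-uw∣v p q = inj₂ (q , p)
        target-other f-uvw  p q = inj₁ (p , q)

        indicator-target-other : ∀ f → indicator u v (target f u v) (other f u v) ≡ 1ℚ
        indicator-target-other f-uv∣w = indicator-on (proj₁ uv)
        indicator-target-other f-wv∣u = indicator-on (proj₁ uv)
        indicator-target-other f-uw∣v = trans (indicator-sym u v v u) (indicator-on (proj₁ uv))
        indicator-target-other f-uvw  = indicator-on (proj₁ uv)

        o : Fin n
        o = other (form u v) u v

        target-or-other : ∀ f (i j z : Fin n) → (z ≡ target f i j) ⊎ (z ≡ other f i j) ⊎ (i ≢ z × j ≢ z)
        target-or-other f i j z = by-cases f (z ≟ i) (z ≟ j)
          where
          by-cases : ∀ f → Dec (z ≡ i) → Dec (z ≡ j) → (z ≡ target f i j) ⊎ (z ≡ other f i j) ⊎ (i ≢ z × j ≢ z)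
          by-cases f       (no z≢i)  (no z≢j)  = inj₂ (inj₂ (z≢i ∘ sym , z≢j ∘ sym))
          by-cases f-uv∣w  (yes z≡i) _         = inj₁ z≡i
          by-cases f-wv∣u  (yes z≡i) _         = inj₁ z≡i
          by-cases f-uw∣v  (yes z≡i) _         = inj₂ (inj₁ z≡i)
          by-cases f-uvw   (yes z≡i) _         = inj₁ z≡i
          by-cases f-uv∣w  _         (yes z≡j) = inj₂ (inj₁ z≡j)
          by-cases f-wv∣u  _         (yes z≡j) = inj₂ (inj₁ z≡j)
          by-cases f-uw∣v  _         (yes z≡j) = inj₁ z≡j
          by-cases f-uvw   _         (yes z≡j) = inj₂ (inj₁ z≡j)

        -- The pair uv belongs to F, so its image is not an edge of `G'`; any other pair of labelled
        -- nodes does not involve x_uv.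
        off-ι-ι : ∀ i j → term (ι i) (ι j) ≡ 0ℚ
        off-ι-ι i j = by-cases (i ≟ u ×-dec j ≟ v) (i ≟ v ×-dec j ≟ u)
          where
          nonedge : adj G' (ι u) (ι v) ≡ false
          nonedge = trans (ι-adj u v (proj₁ uv)) (cong not (proj₂ uv))
          by-cases : Dec (i ≡ u × j ≡ v) → Dec (i ≡ v × j ≡ u) → term (ι i) (ι j) ≡ 0ℚ
          by-cases (yes (refl , refl)) _                   = term-W (ι u) (ι v) (weight-nonedge G' b nonedge)
          by-cases (no _)              (yes (refl , refl)) = term-W (ι v) (ι u) (trans (W-sym (ι v) (ι u)) (weight-nonedge G' b nonedge))
          by-cases (no ne)             (no ne′)            = term-D (ι i) (ι j)
            (trans (cong₂ (indicator u v) (κ-ι i) (κ-ι j)) (indicator-off ne ne′))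

        -- At the target both nodes copy the same node and the indicator is on the diagonal. At the
        -- other endpoint the copied pair is ij, which is uv only in the excluded case. Elsewhere
        -- the entry is zero by `W-w-ι`.
        off-w-ι : ∀ {i j} → InF F i j → ∀ z → ¬ (w i j ≡ w u v × ι z ≡ ι o) → term (w i j) (ι z) ≡ 0ℚ
        off-w-ι {i} {j} ij z ne = by-cases (target-or-other (form i j) i j z)
          where
          f = form i j
          not-uv : z ≡ other f i j → ¬ (i ≡ u × j ≡ v)
          not-uv refl (refl , refl) = ne (refl , refl)
          not-vu : ¬ (i ≡ v × j ≡ u)
          not-vu (refl , refl) = ℕ.<-asym (proj₁ ij) (proj₁ uv)
          by-cases : (z ≡ target f i j) ⊎ (z ≡ other f i j) ⊎ (i ≢ z × j ≢ z) → term (w i j) (ι z) ≡ 0ℚ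
          by-cases (inj₁ z≡t) = term-D (w i j) (ι z)
            (trans (cong₂ (indicator u v) (κ-w ij) (trans (κ-ι z) z≡t)) (indicator-diag u v (target f i j)))
          by-cases (inj₂ (inj₁ z≡o)) = term-D (w i j) (ι z)
            (trans (cong₂ (indicator u v) (κ-w ij) (trans (κ-ι z) z≡o)) (indicator-off
              (λ { (p , q) → refute (target-other f p q) })
              (λ { (p , q) → refute (swap (target-other f p q)) })))
            where
            refute : (i ≡ u × j ≡ v) ⊎ (i ≡ v × j ≡ u) → ⊥
            refute (inj₁ h) = not-uv z≡o h
            refute (inj₂ h) = not-vu h
            swap : (i ≡ v × j ≡ u) ⊎ (i ≡ u × j ≡ v) → (i ≡ u × j ≡ v) ⊎ (i ≡ v × j ≡ u)
            swap (inj₁ h) = inj₂ h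
            swap (inj₂ h) = inj₁ h
          by-cases (inj₂ (inj₂ (i≢z , j≢z))) = term-W (w i j) (ι z) (W-w-ι ij i≢z j≢z)

        off : ∀ p q → Node p → Node q → ¬ (p ≡ w u v × q ≡ ι o) → ¬ (p ≡ ι o × q ≡ w u v) → term p q ≡ 0ℚ
        off p q (inj₁ (i , refl)) (inj₁ (j , refl)) ne ne′ = off-ι-ι i j
        off p q (inj₂ (i , j , ij , refl)) (inj₁ (z , refl)) ne ne′ = off-w-ι ij z ne
        off p q (inj₁ (z , refl)) (inj₂ (i , j , ij , refl)) ne ne′ =
          trans (term-sym (ι z) (w i j)) (off-w-ι ij z λ { (h , k) → ne′ (k , h) })
        off p q (inj₂ (i , j , ij , refl)) (inj₂ (r , s , rs , refl)) ne ne′ = term-W (w i j) (w r s) (W-w-w ij rs)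

      -- The coefficient of x_uv in the functional S ↦ b · δ(ext S), which vanishes.
      W-w-other : W (w u v) (ι o) ≡ 0ℚ
      W-w-other = *-≢0 (trans (sym (∑pairs-single-sym term term-sym (λ h → ι≢w u v o uv (sym h)) λ p q → off p q (node p) (node q))) ∑term) D≢0
        where
        sg-nonzero : ∀ s t → sg s * sg t * 1ℚ ≢ 0ℚ
        sg-nonzero true  true  ()
        sg-nonzero true  false ()
        sg-nonzero false true  ()
        sg-nonzero false false ()
        D≢0 : D (w u v) (ι o) ≢ 0ℚ
        D≢0 h = sg-nonzero (τ (w u v)) (τ (ι o)) (trans (cong (sg (τ (w u v)) * sg (τ (ι o)) *_)
          (sym (trans (cong₂ (indicator u v) (κ-w uv) (κ-ι o)) (indicator-target-other (form u v))))) h)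

      -- Along extensions this pair is never cut or always cut, so it leaves no trace in any
      -- coefficient. At a root where uv is free, however, the relation of the row has only this
      -- term left. Such a root must exist: otherwise the form σ_z, with z a third node, would
      -- vanish vacuously on all of them, against `coefficient-vanishes`.
      W-w-target : W (w u v) (ι (target (form u v) u v)) ≡ 0ℚ
      W-w-target = ≡0-stable (W (w u v) (ι t)) λ W≢0 → ℚ.1≢0 (trans (sym (trans (cong (λ i → 1ℚ * i + 0ℚ) (unit-self z)) (1*1+0 1ℚ)))
        (coefficient-vanishes (distinct (proj₁ uv)) (proj₁ (proj₂ (third-node u v))) (proj₂ (proj₂ (third-node u v)))
          (freeState (form u v)) (λ (_ : Fin 1) → 1ℚ) (λ _ → z) (λ S root free → ⊥-elim (W≢0 (at-free-root S root free)))))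
        where
        t z : Fin n
        t = target (form u v) u v
        z = proj₁ (third-node u v)
        at-free-root : ∀ S → a · Cut S ≡ a0 → S u xor S v ≡ freeState (form u v) → W (w u v) (ι t) ≡ 0ℚ
        at-free-root S root free = sg-cancel (ext S (ι t)) (W (w u v) (ι t)) (trans (ℚ.*-comm (sg (ext S (ι t))) (W (w u v) (ι t)))
          (trans (sym (∑-single (ι t) (λ q → W (w u v) q * sg (ext S q)) (λ q q≢ → trans (cong (_* sg (ext S q)) (elsewhere q q≢ (node q))) (ℚ.*-zeroˡ (sg (ext S q))))))
                 (row-ext uv S root free)))
          where
          elsewhere : ∀ q → q ≢ ι t → Node q → W (w u v) q ≡ 0ℚ
          elsewhere q q≢ (inj₂ (r , s , rs , refl)) = W-w-w uv rs
          elsewhere q q≢ (inj₁ (i , refl)) = by-cases (target-or-other (form u v) u v i)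
            where
            by-cases : (i ≡ t) ⊎ (i ≡ o) ⊎ (u ≢ i × v ≢ i) → W (w u v) (ι i) ≡ 0ℚ
            by-cases (inj₁ i≡t)                 = ⊥-elim (q≢ (cong ι i≡t))
            by-cases (inj₂ (inj₁ i≡o))          = trans (cong (λ i → W (w u v) (ι i)) i≡o) W-w-other
            by-cases (inj₂ (inj₂ (u≢i , v≢i))) = W-w-ι uv u≢i v≢i

      W-w : ∀ q → Node q → W (w u v) q ≡ 0ℚ
      W-w q (inj₂ (r , s , rs , refl)) = W-w-w uv rs
      W-w q (inj₁ (i , refl)) = by-cases (target-or-other (form u v) u v i)
        where
        by-cases : (i ≡ target (form u v) u v) ⊎ (i ≡ o) ⊎ (u ≢ i × v ≢ i) → W (w u v) (ι i) ≡ 0ℚ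
        by-cases (inj₁ i≡t)                 = trans (cong (λ i → W (w u v) (ι i)) i≡t) W-w-target
        by-cases (inj₂ (inj₁ i≡o))          = trans (cong (λ i → W (w u v) (ι i)) i≡o) W-w-other
        by-cases (inj₂ (inj₂ (u≢i , v≢i))) = W-w-ι uv u≢i v≢i

    -- With the rows of all new nodes zero, b · x depends only on the sides of the labelled nodes,
    -- so a cut may be replaced by the extension of its restriction.
    constant : ∀ S → b · cutVec G' S ≡ b0
    constant S = begin
      b · cutVec G' S                                                      ≡⟨ cut-weight G' b S ⟩
      ∑pairs (λ p q → W p q * χ (S p xor S q))                             ≡⟨ ∑pairs-cong (λ p q _ → same p q (node p) (node q)) ⟩
      ∑pairs (λ p q → W p q * χ (ext (S ∘ ι) p xor ext (S ∘ ι) q))         ≡⟨ cut-weight G' b (ext (S ∘ ι)) ⟨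
      b · cutVec G' (ext (S ∘ ι))                                          ≡⟨ on-exts (S ∘ ι) ⟩
      b0                                                                   ∎
      where
      both-zero : ∀ {x} y z → x ≡ 0ℚ → x * y ≡ x * z
      both-zero y z refl = trans (ℚ.*-zeroˡ y) (sym (ℚ.*-zeroˡ z))
      same : ∀ p q → Node p → Node q → W p q * χ (S p xor S q) ≡ W p q * χ (ext (S ∘ ι) p xor ext (S ∘ ι) q)
      same p q (inj₂ (u , v , uv , refl)) o = both-zero (χ (S p xor S q)) (χ (ext (S ∘ ι) p xor ext (S ∘ ι) q)) (W-w uv q o)
      same p q o@(inj₁ _) (inj₂ (u , v , uv , refl)) =
        both-zero (χ (S p xor S q)) (χ (ext (S ∘ ι) p xor ext (S ∘ ι) q)) (trans (W-sym p q) (W-w uv p o))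
      same p q (inj₁ (i , refl)) (inj₁ (j , refl)) =
        cong₂ (λ s t → W (ι i) (ι j) * χ (s xor t)) (sym (ext-ι (S ∘ ι) i)) (sym (ext-ι (S ∘ ι) j))

  private
    combine : PairVec N' → ℚ → PairVec N'
    combine b t p q = b p q + t * a' p q

    combine-· : ∀ b t x → combine b t · x ≡ b · x + t * (a' · x)
    combine-· b t x = begin
      ∑pairs (λ p q → (b p q + t * a' p q) * x p q)
        ≡⟨ ∑pairs-cong (λ p q _ → solve 4 (λ b t a x → (b :+ t :* a) :* x := b :* x :+ t :* (a :* x)) refl (b p q) t (a' p q) (x p q)) ⟩
      ∑pairs (λ p q → b p q * x p q + t * (a' p q * x p q))
        ≡⟨ ∑pairs-+ (λ p q → b p q * x p q) (λ p q → t * (a' p q * x p q)) ⟩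
      b · x + ∑pairs (λ p q → t * (a' p q * x p q))
        ≡⟨ cong (b · x +_) (∑pairs-*ˡ t (λ p q → a' p q * x p q)) ⟩
      b · x + t * (a' · x) ∎

    on-ext-scalar : ∀ B b0 t A a0′ ax a0 → B - b0 ≡ t * (a0 - ax) → A - a0′ ≡ ax - a0 → B + t * A ≡ b0 + t * a0′
    on-ext-scalar B b0 t A a0′ ax a0 hB hA = begin
      B + t * A                                         ≡⟨ solve 5 (λ B b0 t A a0′ → B :+ t :* A := (B :- b0) :+ t :* (A :- a0′) :+ (b0 :+ t :* a0′)) refl B b0 t A a0′ ⟩
      (B - b0) + t * (A - a0′) + (b0 + t * a0′)         ≡⟨ cong₂ (λ p q → p + t * q + (b0 + t * a0′)) hB hA ⟩
      t * (a0 - ax) + t * (ax - a0) + (b0 + t * a0′)    ≡⟨ solve 5 (λ t a0 ax b0 a0′ → t :* (a0 :- ax) :+ t :* (ax :- a0) :+ (b0 :+ t :* a0′) := b0 :+ t :* a0′) refl t a0 ax b0 a0′ ⟩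
      b0 + t * a0′                                      ∎

    negated : ∀ b t x → b + t * x ≡ 0ℚ → b ≡ (- t) * x
    negated b t x h = begin
      b                         ≡⟨ solve 3 (λ b t x → b := (b :+ t :* x) :+ (:- t) :* x) refl b t x ⟩
      (b + t * x) + (- t) * x   ≡⟨ cong (_+ (- t) * x) h ⟩
      0ℚ + (- t) * x            ≡⟨ ℚ.+-identityˡ ((- t) * x) ⟩
      (- t) * x                 ∎

    x≡y⇒x-y≡0 : ∀ {x} y → x ≡ y → x - y ≡ 0ℚ
    x≡y⇒x-y≡0 y refl = ℚ.+-inverseʳ y

  tight-root : ∀ S → Tight S → a · Cut (S ∘ ι) ≡ a0 → a' · cutVec G' S ≡ a0'
  tight-root S tight root = x-y≡0⇒x≡y (a' · cutVec G' S) a0' (trans (tight-excess S tight) (x≡y⇒x-y≡0 a0 root))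

  ext-tight-root : ∀ S → a · Cut S ≡ a0 → a' · cutVec G' (ext S) ≡ a0'
  ext-tight-root S root = x-y≡0⇒x≡y (a' · cutVec G' (ext S)) a0' (trans (ext-excess S) (x≡y⇒x-y≡0 a0 root))

  uniqueness : FacetCriterion.Uniqueness G' a' a0'
  uniqueness b b0 _ b-roots = - t ,
    (λ p q p<q pq → negated (b p q) t (a' p q) (constant-on-cuts-edge G' (combine b t) (b0 + t * a0') constant p<q pq)) ,
    negated b0 t a0' (constant-on-cuts-const G' (combine b t) (b0 + t * a0') constant)
    where
    pulled-multiple : ∃ λ t → ∀ x → pulled b b0 x ≡ t * slack x
    pulled-multiple = multiple-of-slack (affine-pulled b b0) λ S root →
      trans (pulled-Cut b b0 S) (x≡y⇒x-y≡0 b0 (b-roots (ext S) (ext-tight-root S root)))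
    t : ℚ
    t = proj₁ pulled-multiple
    -- Along extensions the eliminated inequality has left side minus right side equal to -`slack`,
    -- while b · x - b₀ equals t times `slack`. Adding t times the former cancels the latter, hence
    -- the final factor `- t`.
    open Rows (combine b t) (b0 + t * a0')
      (λ S → trans (combine-· b t (cutVec G' (ext S)))
        (on-ext-scalar (b · cutVec G' (ext S)) b0 t (a' · cutVec G' (ext S)) a0' (a · Cut S) a0
          (trans (sym (pulled-Cut b b0 S)) (proj₂ pulled-multiple (Cut S))) (ext-excess S)))
      (λ S tight root → trans (combine-· b t (cutVec G' S))
        (cong₂ (λ p q → p + t * q) (b-roots S (tight-root S tight root)) (tight-root S tight root)))
      using (constant)

  facetInducing-elimination : FacetInducing G' a' a0'
  facetInducing-elimination = FacetCriterion.facetInducing G' a' a0' (proj₁ ineq) (valid (proj₁ (proj₂ facet))) proper uniqueness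
    where
    proper : ∃ λ S → a' · cutVec G' S ≢ a0'
    proper = let S , off-face = proj₁ (proj₂ (proj₂ facet)) in
      ext S , λ on-face → off-face (x-y≡0⇒x≡y (a · Cut S) a0 (trans (sym (ext-excess S)) (x≡y⇒x-y≡0 a0' on-face)))

theorem4p1 : (n m N' : ℕ) → 5 ≤ℕ n →
    (part : Fin n → Fin m) → Surj part →
    (G' : Graph N') (ι : Fin n → Fin N') (w : Fin n → Fin n → Fin N') →
    (∀ u v → ι u ≡ ι v → u ≡ v) →
    (∀ u v u₁ v₁ → InF (samePart part) u v → InF (samePart part) u₁ v₁ →
    w u v ≡ w u₁ v₁ → (u ≡ u₁) × (v ≡ v₁)) →
    (∀ u v z → InF (samePart part) u v → ι z ≢ w u v) →
    (∀ p → (∃ λ z → ι z ≡ p) ⊎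
    (∃ λ u → ∃ λ v → InF (samePart part) u v × (w u v ≡ p))) →
    (∀ u v → adj G' (ι u) (ι v) ≡ not (samePart part u v)) →
    (∀ u v u₁ v₁ → InF (samePart part) u v → InF (samePart part) u₁ v₁ →
    part u ≡ part u₁ → adj G' (w u v) (w u₁ v₁) ≡ false) →
    (∀ u v → InF (samePart part) u v →
    (adj G' (ι u) (w u v) ≡ true) × (adj G' (ι v) (w u v) ≡ true)) →
    IsTriElimGraph (K n) (samePart part) G' ι w ×
    (∀ (a : PairVec n) (a0 : ℚ) → FacetInducing (K n) a a0 → ¬ IsTriangle a a0 →
    ∀ (a' : PairVec N') (a0' : ℚ) →
    IsTriElimIneq G' (samePart part) ι w a a0 a' a0' →
    FacetInducing G' a' a0')
-- Three successors are exposed because `third-node` has to supply a node outside a given pair.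
theorem4p1 (suc (suc (suc _))) m N' (s≤s (s≤s (s≤s _))) part _ G' ι w ι-inj w-inj ι≢w cover multipartite _ spokes =
  elim , λ a a0 facet nontriangle a' a0' ineq →
    Vanishing.facetInducing-elimination (samePart part) G' ι w elim a a0 a' a0' ineq facet nontriangle
  where
  elim : IsTriElimGraph (K _) (samePart part) G' ι w
  elim = (λ u v uv → K-adj (distinct (proj₁ uv))) , ι-inj , w-inj , ι≢w , cover ,
         (λ u v uv → trans (Graph.sym G' (w u v) (ι u)) (proj₁ (spokes u v uv)) ,
                     trans (Graph.sym G' (w u v) (ι v)) (proj₂ (spokes u v uv))) ,
         (λ u v _ _ → multipartite u v)
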